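{- For integers $r,m\ge0$, $$\mathcal{Q}_{r,m}^{t,s}(X)=\sum_{k=0}^{m}f_k(t,s)\,q_{r+k}(X;t)\,q_{m-k}(X;s).$$ For $s=t$, this becomes $$\mathcal{Q}_{r,m}^{t,t}(X)=q_r(X;t)q_m(X;t)+2\sum_{k=1}^{m}(-1)^k q_{r+k}(X;t)\,q_{m-k}(X;t).$$
   Context: Let $t,s$ be indeterminates, $\mathbb{K}=\mathbb{Q}(t,s)$, and let operators act on $\Gamma_{\mathbb{K}}=\mathbb{K}[p_1,p_3,p_5,\ldots]$ (with $p_n=p_n(X)$ the odd power sums of an alphabet $X$), with unit element $\mathbf{1}$. For odd $n\ge1$, $a_{ -n}$ is multiplication by $p_n$ and $a_n=\frac n2\frac{\partial}{\partial p_n}$. The modified operator is $$\mathcal{Y}(z;t)=\exp\Big(\sum_{n\ge1,\ n\text{ odd}}\tfrac{2(1-t^n)}n a_{ -n}z^n\Big)\exp\Big(-\sum_{n\ge1,\ n\text{ odd}}\tfrac2{n(1-t^n)} a_nz^{ -n}\Big)=\sum_{m\in\mathbb{Z}}\mathcal{Y}_m(t)z^{ -m},$$ and $\mathcal{Y}(w;s)$ is defined in the same way with $(z,t)$ replaced by $(w,s)$. The modified one-row functions are defined by $$\mathcal{Y}(z;t)\mathbf{1}=\exp\Big(2\sum_{n\ge1,\ n\text{ odd}}\tfrac{1-t^n}{n}p_n(X)z^n\Big)=\sum_{r\ge0}q_r(X;t)z^r,$$ so $q_r(X;t)=\mathcal{Y}_{ -r}(t)\mathbf{1}$. The mixed two-row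 coefficient is $$\mathcal{Q}_{r,m}^{t,s}(X)=[z^rw^m]\,\mathcal{Y}(z;t)\mathcal{Y}(w;s)\mathbf{1}=\mathcal{Y}_{ -r}(t)\mathcal{Y}_{ -m}(s)\mathbf{1}.$$ The coefficients $f_k(t,s)$ are defined by $$\exp\Big(-2\sum_{n\ge1,\ n\text{ odd}}\frac{1-s^n}{1-t^n}\frac{u^n}{n}\Big)=\sum_{k\ge0}f_k(t,s)u^k.$$ For $s=t$ the same definitions are used with both parameters equal to $t$, over $\mathbb{Q}(t)$. -}

module Defs where

open import Level using (0ℓ) renaming (suc to lsuc)
open import Algebra.Bundles using (CommutativeRing; RawSemiring)
open import Algebra.Apartness.Bundles using (HeytingCommutativeRing; HeytingField)
open import Algebra.Consequences.Setoid using (comm∧idˡ⇒id; comm∧invˡ⇒inv; comm∧distrʳ⇒distr)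
import Algebra.Definitions.RawSemiring as RawSemiringOps
import Algebra.Properties.Group as GroupProperties
import Algebra.Properties.Ring as RingProperties
import Algebra.Properties.CommutativeSemigroup as CommutativeSemigroupProperties
open import Data.Fin.Base using (Fin; zero; suc; toℕ)
open import Data.Fin.Properties using (toℕ≤pred[n])
open import Data.Integer.Base as ℤ using (ℤ; +_; -[1+_])
open import Data.List.Base using (List; []; _∷_; map)
open import Data.Nat.Base as ℕ using (ℕ; zero; suc; NonZero; _∸_; _⊔_; _!; z≤n; s≤s)
import Data.Nat.Properties as ℕₚ
open import Data.Product.Base using (_,_; proj₁; proj₂)
open import Data.Rational.Base as ℚ using (ℚ; 0ℚ; 1ℚ)
import Data.Rational.Properties as ℚₚ
open import Data.Sum.Base using (_⊎_; inj₁; inj₂; [_,_]′)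
open import Function.Base using (_∘_; id; const)
open import Relation.Binary.Bundles using (Setoid; DecSetoid)
open import Relation.Binary.Definitions using (Decidable)
open import Relation.Binary.PropositionalEquality as ≡ using (_≡_; _≢_; module ≡-Reasoning)
import Relation.Binary.Properties.DecSetoid as DecSetoidProperties
import Relation.Binary.Reasoning.Setoid as SetoidReasoning
open import Relation.Nullary using (¬_; Dec; yes; no; contradiction)
open import Relation.Nullary.Decidable using (map′; _×-dec_)

rawSemiringOf : CommutativeRing 0ℓ 0ℓ → RawSemiring 0ℓ 0ℓ
rawSemiringOf R = record { CommutativeRing R }

record Domain₀ : Set₁ where
  field
    commutativeRing : CommutativeRing 0ℓ 0ℓ
  open CommutativeRing commutativeRing public
  open RawSemiringOps (rawSemiringOf commutativeRing) public
    using (_×_; _^_)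
  infix 4 _≟_
  field
    _≟_            : Decidable _≈_
    noZeroDivisors : ∀ {x y} → x * y ≈ 0# → x ≈ 0# ⊎ y ≈ 0#
    charZero       : ∀ n .{{_ : NonZero n}} → n × 1# ≉ 0#

  1≉0 : 1# ≉ 0#
  1≉0 eq = charZero 1 (trans (+-identityʳ 1#) eq)

record Field₀ : Set₁ where
  field
    heytingField : HeytingField 0ℓ 0ℓ 0ℓ
  open HeytingField heytingField public

  rawSemiring : RawSemiring 0ℓ 0ℓ
  rawSemiring = record { HeytingField heytingField }

  open RawSemiringOps rawSemiring public using (_×_; _^_)
  field
    charZero : ∀ n .{{_ : NonZero n}} → (n × 1#) # 0#

  -- Multiplicative inverse of x - y.
  1/[_] : ∀ {x y} → x # y → Carrier
  1/[ x#y ] = proj₁ (#⇒invertible x#y)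

  1/ : (n : ℕ) .{{_ : NonZero n}} → Carrier
  1/ n = 1/[ charZero n ]

-- A value t of the deformation parameter: every 1 - tⁿ with n ≥ 1 must be
-- invertible for 𝒴(z;t) to be defined.
record Parameter (F : Field₀) : Set where
  open Field₀ F
  field
    val   : Carrier
    1#val : ∀ n .{{_ : NonZero n}} → 1# # (val ^ n)

ℚ-domain : Domain₀
ℚ-domain = record
  { commutativeRing = ℚₚ.+-*-commutativeRing
  ; _≟_             = ℚₚ._≟_
  ; noZeroDivisors  = λ {x} {y} → integral x y
  ; charZero        = λ { (suc n) eq → ℚₚ.<⇒≢ (positive n) (≡.sym eq) }
  }
  where
  open RawSemiringOps (rawSemiringOf ℚₚ.+-*-commutativeRing) using (_×_)

  integral : ∀ x y → x ℚ.* y ≡ 0ℚ → x ≡ 0ℚ ⊎ y ≡ 0ℚ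
  integral x y eq with x ℚₚ.≟ 0ℚ
  ... | yes x≡0 = inj₁ x≡0
  ... | no  x≢0 = inj₂ (begin
    y                       ≡⟨ ℚₚ.*-identityˡ y ⟨
    1ℚ ℚ.* y                ≡⟨ ≡.cong (ℚ._* y) (ℚₚ.*-inverseˡ x) ⟨
    (ℚ.1/ x) ℚ.* x ℚ.* y    ≡⟨ ℚₚ.*-assoc (ℚ.1/ x) x y ⟩
    (ℚ.1/ x) ℚ.* (x ℚ.* y)  ≡⟨ ≡.cong ((ℚ.1/ x) ℚ.*_) eq ⟩
    (ℚ.1/ x) ℚ.* 0ℚ         ≡⟨ ℚₚ.*-zeroʳ (ℚ.1/ x) ⟩
    0ℚ                      ∎)
    where
    instance _ = ℚ.≢-nonZero x≢0
    open ≡-Reasoning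

  0<1 : 0ℚ ℚ.< 1ℚ
  0<1 = ℚₚ.positive⁻¹ 1ℚ

  nonNegative : ∀ n → 0ℚ ℚ.≤ n × 1ℚ
  nonNegative zero    = ℚₚ.≤-refl
  nonNegative (suc n) = ℚₚ.+-mono-≤ (ℚₚ.<⇒≤ 0<1) (nonNegative n)

  positive : ∀ n → 0ℚ ℚ.< suc n × 1ℚ
  positive n = ℚₚ.+-mono-<-≤ 0<1 (nonNegative n)

-- Univariate polynomials are lists of coefficients, constant term first;
-- the equality ignores trailing zeros.
module Polynomial (D : Domain₀) where
  private module D = Domain₀ D
  open D using (_≈_; 0#; 1#) renaming (Carrier to A)
  open RingProperties D.ring using (-0#≈0#)
  private module S = SetoidReasoning D.setoid

  Poly : Set
  Poly = List A

  coeff : Poly → ℕ → A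
  coeff []      _       = 0#
  coeff (a ∷ p) zero    = a
  coeff (a ∷ p) (suc n) = coeff p n

  infix 4 _≋_
  record _≋_ (p q : Poly) : Set where
    constructor coeffwise
    field at : ∀ n → coeff p n ≈ coeff q n
  open _≋_ public

  C : A → Poly
  C a = a ∷ []

  X : Poly
  X = 0# ∷ 1# ∷ []

  infixl 6 _⊕_
  infixl 7 _⊗_ _·_

  _⊕_ : Poly → Poly → Poly
  []      ⊕ q       = q
  (a ∷ p) ⊕ []      = a ∷ p
  (a ∷ p) ⊕ (b ∷ q) = (a D.+ b) ∷ (p ⊕ q)

  ⊖_ : Poly → Poly
  ⊖_ = map (λ a → D.- a)

  _·_ : A → Poly → Poly
  a · p = map (a D.*_) p

  _⊗_ : Poly → Poly → Poly
  []      ⊗ q = []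
  (a ∷ p) ⊗ q = a · q ⊕ (0# ∷ p ⊗ q)

  ≋-setoid : Setoid 0ℓ 0ℓ
  ≋-setoid = record
    { Carrier       = Poly
    ; _≈_           = _≋_
    ; isEquivalence = record
      { refl  = coeffwise λ _ → D.refl
      ; sym   = λ e → coeffwise λ n → D.sym (at e n)
      ; trans = λ e f → coeffwise λ n → D.trans (at e n) (at f n)
      }
    }
  open Setoid ≋-setoid using () renaming (refl to ≋-refl; sym to ≋-sym; trans to ≋-trans)
  private module R = SetoidReasoning ≋-setoid

  ∷-cong : ∀ {a b p q} → a ≈ b → p ≋ q → a ∷ p ≋ b ∷ q
  ∷-cong a≈b p≋q = coeffwise λ { zero → a≈b ; (suc n) → at p≋q n }

  tail-cong : ∀ {a b p q} → a ∷ p ≋ b ∷ q → p ≋ q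
  tail-cong e = coeffwise (at e ∘ suc)

  ∷≋[] : ∀ {a p} → a ≈ 0# → p ≋ [] → a ∷ p ≋ []
  ∷≋[] a≈0 p≋0 = coeffwise λ { zero → a≈0 ; (suc n) → at p≋0 n }

  tail≋[] : ∀ {a p} → a ∷ p ≋ [] → p ≋ []
  tail≋[] e = coeffwise (at e ∘ suc)

  coeff-⊕ : ∀ p q n → coeff (p ⊕ q) n ≈ coeff p n D.+ coeff q n
  coeff-⊕ []      q       n       = D.sym (D.+-identityˡ _)
  coeff-⊕ (a ∷ p) []      n       = D.sym (D.+-identityʳ _)
  coeff-⊕ (a ∷ p) (b ∷ q) zero    = D.refl
  coeff-⊕ (a ∷ p) (b ∷ q) (suc n) = coeff-⊕ p q n

  coeff-⊖ : ∀ p n → coeff (⊖ p) n ≈ D.- coeff p n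
  coeff-⊖ []      n       = D.sym -0#≈0#
  coeff-⊖ (a ∷ p) zero    = D.refl
  coeff-⊖ (a ∷ p) (suc n) = coeff-⊖ p n

  coeff-· : ∀ a p n → coeff (a · p) n ≈ a D.* coeff p n
  coeff-· a []      n       = D.sym (D.zeroʳ a)
  coeff-· a (b ∷ p) zero    = D.refl
  coeff-· a (b ∷ p) (suc n) = coeff-· a p n

  ⊕-cong : ∀ {p p′ q q′} → p ≋ p′ → q ≋ q′ → p ⊕ q ≋ p′ ⊕ q′
  ⊕-cong {p} {p′} {q} {q′} e f = coeffwise λ n → S.begin
    coeff (p ⊕ q) n             S.≈⟨ coeff-⊕ p q n ⟩
    coeff p n D.+ coeff q n     S.≈⟨ D.+-cong (at e n) (at f n) ⟩
    coeff p′ n D.+ coeff q′ n   S.≈⟨ coeff-⊕ p′ q′ n ⟨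
    coeff (p′ ⊕ q′) n           S.∎

  ⊕-congˡ : ∀ p {q q′} → q ≋ q′ → p ⊕ q ≋ p ⊕ q′
  ⊕-congˡ p = ⊕-cong {p} ≋-refl

  ⊕-comm : ∀ p q → p ⊕ q ≋ q ⊕ p
  ⊕-comm p q = coeffwise λ n → S.begin
    coeff (p ⊕ q) n            S.≈⟨ coeff-⊕ p q n ⟩
    coeff p n D.+ coeff q n    S.≈⟨ D.+-comm _ _ ⟩
    coeff q n D.+ coeff p n    S.≈⟨ coeff-⊕ q p n ⟨
    coeff (q ⊕ p) n            S.∎

  ⊕-assoc : ∀ p q r → (p ⊕ q) ⊕ r ≋ p ⊕ (q ⊕ r)
  ⊕-assoc p q r = coeffwise λ n → S.begin
    coeff ((p ⊕ q) ⊕ r) n                        S.≈⟨ coeff-⊕ (p ⊕ q) r n ⟩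
    coeff (p ⊕ q) n D.+ coeff r n                S.≈⟨ D.+-congʳ (coeff-⊕ p q n) ⟩
    coeff p n D.+ coeff q n D.+ coeff r n        S.≈⟨ D.+-assoc _ _ _ ⟩
    coeff p n D.+ (coeff q n D.+ coeff r n)      S.≈⟨ D.+-congˡ (coeff-⊕ q r n) ⟨
    coeff p n D.+ coeff (q ⊕ r) n                S.≈⟨ coeff-⊕ p (q ⊕ r) n ⟨
    coeff (p ⊕ (q ⊕ r)) n                        S.∎

  ⊖-cong : ∀ {p q} → p ≋ q → ⊖ p ≋ ⊖ q
  ⊖-cong {p} {q} e = coeffwise λ n →
    D.trans (coeff-⊖ p n) (D.trans (D.-‿cong (at e n)) (D.sym (coeff-⊖ q n)))

  ⊖-inverseˡ : ∀ p → ⊖ p ⊕ p ≋ []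
  ⊖-inverseˡ p = coeffwise λ n → S.begin
    coeff (⊖ p ⊕ p) n              S.≈⟨ coeff-⊕ (⊖ p) p n ⟩
    coeff (⊖ p) n D.+ coeff p n    S.≈⟨ D.+-congʳ (coeff-⊖ p n) ⟩
    D.- coeff p n D.+ coeff p n    S.≈⟨ D.-‿inverseˡ _ ⟩
    0#                             S.∎

  ·-cong : ∀ {a b p q} → a ≈ b → p ≋ q → a · p ≋ b · q
  ·-cong {a} {b} {p} {q} e f = coeffwise λ n →
    D.trans (coeff-· a p n) (D.trans (D.*-cong e (at f n)) (D.sym (coeff-· b q n)))

  ·-distribʳ : ∀ a b p → (a D.+ b) · p ≋ a · p ⊕ b · p
  ·-distribʳ a b p = coeffwise λ n → S.begin
    coeff ((a D.+ b) · p) n                  S.≈⟨ coeff-· _ p n ⟩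
    (a D.+ b) D.* coeff p n                  S.≈⟨ D.distribʳ _ a b ⟩
    a D.* coeff p n D.+ b D.* coeff p n      S.≈⟨ D.+-cong (coeff-· a p n) (coeff-· b p n) ⟨
    coeff (a · p) n D.+ coeff (b · p) n      S.≈⟨ coeff-⊕ (a · p) (b · p) n ⟨
    coeff (a · p ⊕ b · p) n                  S.∎

  ·-distribˡ : ∀ a p q → a · (p ⊕ q) ≋ a · p ⊕ a · q
  ·-distribˡ a p q = coeffwise λ n → S.begin
    coeff (a · (p ⊕ q)) n                    S.≈⟨ coeff-· a (p ⊕ q) n ⟩
    a D.* coeff (p ⊕ q) n                    S.≈⟨ D.*-congˡ (coeff-⊕ p q n) ⟩
    a D.* (coeff p n D.+ coeff q n)          S.≈⟨ D.distribˡ a _ _ ⟩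
    a D.* coeff p n D.+ a D.* coeff q n      S.≈⟨ D.+-cong (coeff-· a p n) (coeff-· a q n) ⟨
    coeff (a · p) n D.+ coeff (a · q) n      S.≈⟨ coeff-⊕ (a · p) (a · q) n ⟨
    coeff (a · p ⊕ a · q) n                  S.∎

  ·-assoc : ∀ a b p → (a D.* b) · p ≋ a · (b · p)
  ·-assoc a b p = coeffwise λ n → S.begin
    coeff ((a D.* b) · p) n     S.≈⟨ coeff-· _ p n ⟩
    a D.* b D.* coeff p n       S.≈⟨ D.*-assoc a b _ ⟩
    a D.* (b D.* coeff p n)     S.≈⟨ D.*-congˡ (coeff-· b p n) ⟨
    a D.* coeff (b · p) n       S.≈⟨ coeff-· a (b · p) n ⟨
    coeff (a · (b · p)) n       S.∎

  ·-identity : ∀ p → 1# · p ≋ p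
  ·-identity p = coeffwise λ n → D.trans (coeff-· 1# p n) (D.*-identityˡ _)

  ·-zero : ∀ {a} p → a ≈ 0# → a · p ≋ []
  ·-zero {a} p e = coeffwise λ n →
    D.trans (coeff-· a p n) (D.trans (D.*-congʳ e) (D.zeroˡ _))

  shift-⊕ : ∀ p q → 0# ∷ (p ⊕ q) ≋ (0# ∷ p) ⊕ (0# ∷ q)
  shift-⊕ p q = ∷-cong (D.sym (D.+-identityˡ 0#)) ≋-refl

  ⊕-interchange : ∀ p q r s → (p ⊕ q) ⊕ (r ⊕ s) ≋ (p ⊕ r) ⊕ (q ⊕ s)
  ⊕-interchange p q r s = R.begin
    (p ⊕ q) ⊕ (r ⊕ s)   R.≈⟨ ⊕-assoc p q (r ⊕ s) ⟩
    p ⊕ (q ⊕ (r ⊕ s))   R.≈⟨ ⊕-congˡ p (⊕-assoc q r s) ⟨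
    p ⊕ ((q ⊕ r) ⊕ s)   R.≈⟨ ⊕-congˡ p (⊕-cong (⊕-comm q r) (≋-refl {s})) ⟩
    p ⊕ ((r ⊕ q) ⊕ s)   R.≈⟨ ⊕-congˡ p (⊕-assoc r q s) ⟩
    p ⊕ (r ⊕ (q ⊕ s))   R.≈⟨ ⊕-assoc p r (q ⊕ s) ⟨
    (p ⊕ r) ⊕ (q ⊕ s)   R.∎

  ⊗-zeroˡ : ∀ {p} q → p ≋ [] → p ⊗ q ≋ []
  ⊗-zeroˡ {[]}    q e = ≋-refl
  ⊗-zeroˡ {a ∷ p} q e =
    ⊕-cong (·-zero q (at e 0)) (∷≋[] D.refl (⊗-zeroˡ q (tail≋[] e)))

  ⊗-congʳ : ∀ {p p′} q → p ≋ p′ → p ⊗ q ≋ p′ ⊗ q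
  ⊗-congʳ {[]}    {p′}     q e = ≋-sym (⊗-zeroˡ q (≋-sym e))
  ⊗-congʳ {a ∷ p} {[]}     q e = ⊗-zeroˡ q e
  ⊗-congʳ {a ∷ p} {b ∷ p′} q e =
    ⊕-cong (·-cong (at e 0) ≋-refl) (∷-cong D.refl (⊗-congʳ q (tail-cong e)))

  ⊗-zeroʳ : ∀ p → p ⊗ [] ≋ []
  ⊗-zeroʳ []      = ≋-refl
  ⊗-zeroʳ (a ∷ p) = ∷≋[] D.refl (⊗-zeroʳ p)

  ⊗-∷ : ∀ p b q → p ⊗ (b ∷ q) ≋ b · p ⊕ (0# ∷ p ⊗ q)
  ⊗-∷ []      b q = ≋-sym (∷≋[] D.refl ≋-refl)
  ⊗-∷ (a ∷ p) b q = ∷-cong (D.+-congʳ (D.*-comm a b)) (R.begin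
    a · q ⊕ p ⊗ (b ∷ q)                  R.≈⟨ ⊕-cong ≋-refl (⊗-∷ p b q) ⟩
    a · q ⊕ (b · p ⊕ (0# ∷ p ⊗ q))       R.≈⟨ ⊕-assoc (a · q) (b · p) _ ⟨
    (a · q ⊕ b · p) ⊕ (0# ∷ p ⊗ q)       R.≈⟨ ⊕-cong (⊕-comm (a · q) (b · p)) ≋-refl ⟩
    (b · p ⊕ a · q) ⊕ (0# ∷ p ⊗ q)       R.≈⟨ ⊕-assoc (b · p) (a · q) _ ⟩
    b · p ⊕ (a · q ⊕ (0# ∷ p ⊗ q))       R.∎)

  ⊗-comm : ∀ p q → p ⊗ q ≋ q ⊗ p
  ⊗-comm []      q = ≋-sym (⊗-zeroʳ q)
  ⊗-comm (a ∷ p) q = ≋-trans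
    (⊕-cong ≋-refl (∷-cong D.refl (⊗-comm p q))) (≋-sym (⊗-∷ q a p))

  ⊗-cong : ∀ {p p′ q q′} → p ≋ p′ → q ≋ q′ → p ⊗ q ≋ p′ ⊗ q′
  ⊗-cong {p} {p′} {q} {q′} e f = R.begin
    p ⊗ q     R.≈⟨ ⊗-congʳ q e ⟩
    p′ ⊗ q    R.≈⟨ ⊗-comm p′ q ⟩
    q ⊗ p′    R.≈⟨ ⊗-congʳ p′ f ⟩
    q′ ⊗ p′   R.≈⟨ ⊗-comm q′ p′ ⟩
    p′ ⊗ q′   R.∎

  ⊗-distribʳ : ∀ r p q → (p ⊕ q) ⊗ r ≋ p ⊗ r ⊕ q ⊗ r
  ⊗-distribʳ r []      q       = ≋-refl
  ⊗-distribʳ r (a ∷ p) []      = ⊕-comm [] ((a ∷ p) ⊗ r)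
  ⊗-distribʳ r (a ∷ p) (b ∷ q) = R.begin
    (a D.+ b) · r ⊕ (0# ∷ (p ⊕ q) ⊗ r)
      R.≈⟨ ⊕-cong (·-distribʳ a b r) (∷-cong D.refl (⊗-distribʳ r p q)) ⟩
    (a · r ⊕ b · r) ⊕ (0# ∷ (p ⊗ r ⊕ q ⊗ r))
      R.≈⟨ ⊕-cong ≋-refl (shift-⊕ (p ⊗ r) (q ⊗ r)) ⟩
    (a · r ⊕ b · r) ⊕ ((0# ∷ p ⊗ r) ⊕ (0# ∷ q ⊗ r))
      R.≈⟨ ⊕-interchange (a · r) (b · r) _ _ ⟩
    (a · r ⊕ (0# ∷ p ⊗ r)) ⊕ (b · r ⊕ (0# ∷ q ⊗ r)) R.∎

  ·-⊗ : ∀ a p q → (a · p) ⊗ q ≋ a · (p ⊗ q)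
  ·-⊗ a []      q = ≋-refl
  ·-⊗ a (b ∷ p) q = R.begin
    (a D.* b) · q ⊕ (0# ∷ (a · p) ⊗ q)
      R.≈⟨ ⊕-cong (·-assoc a b q) (∷-cong (D.sym (D.zeroʳ a)) (·-⊗ a p q)) ⟩
    a · (b · q) ⊕ a · (0# ∷ p ⊗ q)
      R.≈⟨ ·-distribˡ a (b · q) (0# ∷ p ⊗ q) ⟨
    a · (b · q ⊕ (0# ∷ p ⊗ q)) R.∎

  shift-⊗ : ∀ p q → (0# ∷ p) ⊗ q ≋ 0# ∷ p ⊗ q
  shift-⊗ p q = ⊕-cong (·-zero q D.refl) ≋-refl

  ⊗-assoc : ∀ p q r → (p ⊗ q) ⊗ r ≋ p ⊗ (q ⊗ r)
  ⊗-assoc []      q r = ≋-refl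
  ⊗-assoc (a ∷ p) q r = R.begin
    (a · q ⊕ (0# ∷ p ⊗ q)) ⊗ r
      R.≈⟨ ⊗-distribʳ r (a · q) (0# ∷ p ⊗ q) ⟩
    (a · q) ⊗ r ⊕ (0# ∷ p ⊗ q) ⊗ r
      R.≈⟨ ⊕-cong (·-⊗ a q r) (shift-⊗ (p ⊗ q) r) ⟩
    a · (q ⊗ r) ⊕ (0# ∷ (p ⊗ q) ⊗ r)
      R.≈⟨ ⊕-cong ≋-refl (∷-cong D.refl (⊗-assoc p q r)) ⟩
    a · (q ⊗ r) ⊕ (0# ∷ p ⊗ (q ⊗ r)) R.∎

  ⊗-identityˡ : ∀ p → C 1# ⊗ p ≋ p
  ⊗-identityˡ p = R.begin
    1# · p ⊕ (0# ∷ [])   R.≈⟨ ⊕-cong (·-identity p) (∷≋[] D.refl ≋-refl) ⟩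
    p ⊕ []               R.≈⟨ ⊕-comm p [] ⟩
    p                    R.∎

  polynomialRing : CommutativeRing 0ℓ 0ℓ
  polynomialRing = record
    { Carrier = Poly
    ; _≈_     = _≋_
    ; _+_     = _⊕_
    ; _*_     = _⊗_
    ; -_      = ⊖_
    ; 0#      = []
    ; 1#      = C 1#
    ; isCommutativeRing = record
      { isRing = record
        { +-isAbelianGroup = record
          { isGroup = record
            { isMonoid = record
              { isSemigroup = record
                { isMagma = record { isEquivalence = Setoid.isEquivalence ≋-setoid ; ∙-cong = ⊕-cong }
                ; assoc   = ⊕-assoc
                }
              ; identity = comm∧idˡ⇒id ≋-setoid ⊕-comm (λ _ → ≋-refl)
              }
            ; inverse = comm∧invˡ⇒inv ≋-setoid ⊕-comm ⊖-inverseˡ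
            ; ⁻¹-cong = ⊖-cong
            }
          ; comm = ⊕-comm
          }
        ; *-cong     = ⊗-cong
        ; *-assoc    = ⊗-assoc
        ; *-identity = comm∧idˡ⇒id ≋-setoid ⊗-comm ⊗-identityˡ
        ; distrib    = comm∧distrʳ⇒distr ≋-setoid ⊕-cong ⊗-comm ⊗-distribʳ
        }
      ; *-comm = ⊗-comm
      }
    }

  ≋[]? : ∀ p → Dec (p ≋ [])
  ≋[]? []      = yes ≋-refl
  ≋[]? (a ∷ p) = map′ (λ (e , f) → ∷≋[] e f) (λ e → at e 0 , tail≋[] e) ((a D.≟ 0#) ×-dec ≋[]? p)

  _≋?_ : Decidable _≋_
  []      ≋? q       = map′ ≋-sym ≋-sym (≋[]? q)
  (a ∷ p) ≋? []      = ≋[]? (a ∷ p)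
  (a ∷ p) ≋? (b ∷ q) = map′ (λ (e , f) → ∷-cong e f) (λ e → at e 0 , tail-cong e) ((a D.≟ b) ×-dec (p ≋? q))

  integral-step : ∀ a p b q →
    (p ⊗ (b ∷ q) ≋ [] → p ≋ [] ⊎ b ∷ q ≋ []) →
    ((a ∷ p) ⊗ q ≋ [] → a ∷ p ≋ [] ⊎ q ≋ []) →
    (a ∷ p) ⊗ (b ∷ q) ≋ [] → a ∷ p ≋ [] ⊎ b ∷ q ≋ []
  integral-step a p b q recˡ recʳ e with a D.≟ 0# | b D.≟ 0#
  ... | yes a≈0 | _ =
    [ (λ p≋0 → inj₁ (∷≋[] a≈0 p≋0)) , inj₂ ]′ (recˡ (tail≋[] (R.begin
      0# ∷ p ⊗ (b ∷ q)     R.≈⟨ shift-⊗ p (b ∷ q) ⟨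
      (0# ∷ p) ⊗ (b ∷ q)   R.≈⟨ ⊗-congʳ (b ∷ q) (∷-cong {p = p} a≈0 ≋-refl) ⟨
      (a ∷ p) ⊗ (b ∷ q)    R.≈⟨ e ⟩
      []                   R.∎)))
  ... | no _    | yes b≈0 =
    [ inj₁ , (λ q≋0 → inj₂ (∷≋[] b≈0 q≋0)) ]′ (recʳ (tail≋[] (R.begin
      0# ∷ (a ∷ p) ⊗ q                    R.≈⟨ ⊕-cong (·-zero (a ∷ p) b≈0) ≋-refl ⟨
      b · (a ∷ p) ⊕ (0# ∷ (a ∷ p) ⊗ q)    R.≈⟨ ⊗-∷ (a ∷ p) b q ⟨
      (a ∷ p) ⊗ (b ∷ q)                   R.≈⟨ e ⟩
      []                                  R.∎)))
  ... | no a≉0  | no b≉0 =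
    contradiction (D.noZeroDivisors (D.trans (D.sym (D.+-identityʳ _)) (at e 0))) [ a≉0 , b≉0 ]′

  integral : ∀ p q → p ⊗ q ≋ [] → p ≋ [] ⊎ q ≋ []
  integral []      q       = λ _ → inj₁ ≋-refl
  integral (a ∷ p) []      = λ _ → inj₂ ≋-refl
  integral (a ∷ p) (b ∷ q) = integral-step a p b q (integral p (b ∷ q)) (integral (a ∷ p) q)

  private
    module P = RawSemiringOps (rawSemiringOf polynomialRing)

  coeff-× : ∀ n → coeff (n P.× C 1#) 0 ≈ n D.× 1#
  coeff-× zero    = D.refl
  coeff-× (suc n) = D.trans (coeff-⊕ (C 1#) (n P.× C 1#) 0) (D.+-congˡ (coeff-× n))

  polynomialDomain : Domain₀
  polynomialDomain = record
    { commutativeRing = polynomialRing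
    ; _≟_             = _≋?_
    ; noZeroDivisors  = λ {p} {q} → integral p q
    ; charZero        = λ n eq → D.charZero n (D.trans (D.sym (coeff-× n)) (at eq 0))
    }

  1≉X^ : ∀ n .{{_ : NonZero n}} → ¬ (C 1# ≋ X P.^ n)
  1≉X^ (suc n) eq = D.1≉0 (D.trans (at eq 0) (at (shift-⊗ (C 1#) (X P.^ n)) 0))

  C-^ : ∀ a n → C (a D.^ n) ≋ C a P.^ n
  C-^ a zero    = ≋-refl
  C-^ a (suc n) = R.begin
    C (a D.* a D.^ n)     R.≈⟨ ∷-cong (D.+-identityʳ _) ≋-refl ⟨
    C a ⊗ C (a D.^ n)     R.≈⟨ ⊗-cong {C a} ≋-refl (C-^ a n) ⟩
    C a ⊗ C a P.^ n       R.∎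

  1≉C^ : ∀ {a} n → ¬ (1# ≈ a D.^ n) → ¬ (C 1# ≋ C a P.^ n)
  1≉C^ {a} n 1≉aⁿ eq = 1≉aⁿ (at (≋-trans eq (≋-sym (C-^ a n))) 0)

module Fractions (D : Domain₀) where
  private module D = Domain₀ D
  open D using (_≈_; _≉_; 0#; 1#; _+_; _*_; -_) renaming (Carrier to A)
  open RingProperties D.ring using (-‿distribˡ-*; -‿distribʳ-*)
  open GroupProperties D.+-group using () renaming (∙-cancelˡ to +-cancelˡ)
  open CommutativeSemigroupProperties D.*-commutativeSemigroup
    using (interchange; xy∙z≈xz∙y; x∙yz≈y∙xz)
  open SetoidReasoning D.setoid

  record Fraction : Set where
    constructor _/_⟨_⟩
    field
      num   : A
      den   : A
      den≉0 : den ≉ 0#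
  open Fraction public

  infix 4 _≃_
  record _≃_ (x y : Fraction) : Set where
    constructor cross
    field uncross : num x * den y ≈ num y * den x
  open _≃_ public

  *-≉0 : ∀ {a b} → a ≉ 0# → b ≉ 0# → a * b ≉ 0#
  *-≉0 a≉0 b≉0 ab≈0 = [ a≉0 , b≉0 ]′ (D.noZeroDivisors ab≈0)

  *-cancelʳ : ∀ {a b c} → c ≉ 0# → a * c ≈ b * c → a ≈ b
  *-cancelʳ {a} {b} {c} c≉0 eq =
    [ (λ a-b≈0 → GroupProperties.x∙y⁻¹≈ε⇒x≈y D.+-group a b a-b≈0) , (λ c≈0 → contradiction c≈0 c≉0) ]′
      (D.noZeroDivisors (begin
        (a + - b) * c       ≈⟨ D.distribʳ c a (- b) ⟩
        a * c + - b * c     ≈⟨ D.+-cong eq (D.sym (-‿distribˡ-* b c)) ⟩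
        b * c + - (b * c)   ≈⟨ D.-‿inverseʳ (b * c) ⟩
        0#                  ∎))

  embed : A → Fraction
  embed a = a / 1# ⟨ D.1≉0 ⟩

  infixl 6 _⊞_
  infixl 7 _⊠_

  _⊞_ : Fraction → Fraction → Fraction
  (a / b ⟨ b≉0 ⟩) ⊞ (c / d ⟨ d≉0 ⟩) = (a * d + c * b) / (b * d) ⟨ *-≉0 b≉0 d≉0 ⟩

  _⊠_ : Fraction → Fraction → Fraction
  (a / b ⟨ b≉0 ⟩) ⊠ (c / d ⟨ d≉0 ⟩) = (a * c) / (b * d) ⟨ *-≉0 b≉0 d≉0 ⟩

  ⊟_ : Fraction → Fraction
  ⊟ (a / b ⟨ b≉0 ⟩) = (- a) / b ⟨ b≉0 ⟩

  0F 1F : Fraction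
  0F = embed 0#
  1F = embed 1#

  ≃-trans : ∀ {x y z} → x ≃ y → y ≃ z → x ≃ z
  ≃-trans {a / b ⟨ _ ⟩} {c / d ⟨ d≉0 ⟩} {e / f ⟨ _ ⟩} (cross ad≈cb) (cross cf≈ed) =
    cross (*-cancelʳ d≉0 (begin
      a * f * d   ≈⟨ xy∙z≈xz∙y a f d ⟩
      a * d * f   ≈⟨ D.*-congʳ ad≈cb ⟩
      c * b * f   ≈⟨ xy∙z≈xz∙y c b f ⟩
      c * f * b   ≈⟨ D.*-congʳ cf≈ed ⟩
      e * d * b   ≈⟨ xy∙z≈xz∙y e d b ⟩
      e * b * d   ∎))

  ≃-setoid : Setoid 0ℓ 0ℓ
  ≃-setoid = record
    { Carrier       = Fraction
    ; _≈_           = _≃_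
    ; isEquivalence = record
      { refl  = cross D.refl
      ; sym   = λ (cross e) → cross (D.sym e)
      ; trans = ≃-trans
      }
    }

  _≃?_ : Decidable _≃_
  x ≃? y = map′ cross uncross (num x * den y D.≟ num y * den x)

  ≃-parts : ∀ {x y} → num x ≈ num y → den x ≈ den y → x ≃ y
  ≃-parts e f = cross (D.*-cong e (D.sym f))

  ⊠-cong : ∀ {x x′ y y′} → x ≃ x′ → y ≃ y′ → x ⊠ y ≃ x′ ⊠ y′
  ⊠-cong {a / b ⟨ _ ⟩} {a′ / b′ ⟨ _ ⟩} {c / d ⟨ _ ⟩} {c′ / d′ ⟨ _ ⟩} (cross e) (cross f) = cross (begin
    a * c * (b′ * d′)     ≈⟨ interchange a c b′ d′ ⟩
    a * b′ * (c * d′)     ≈⟨ D.*-cong e f ⟩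
    a′ * b * (c′ * d)     ≈⟨ interchange a′ b c′ d ⟩
    a′ * c′ * (b * d)     ∎)

  ⊞-comm : ∀ x y → x ⊞ y ≃ y ⊞ x
  ⊞-comm (a / b ⟨ _ ⟩) (c / d ⟨ _ ⟩) = ≃-parts (D.+-comm _ _) (D.*-comm b d)

  ⊞-congʳ : ∀ {x x′ y} → x ≃ x′ → x ⊞ y ≃ x′ ⊞ y
  ⊞-congʳ {a / b ⟨ _ ⟩} {a′ / b′ ⟨ _ ⟩} {c / d ⟨ _ ⟩} (cross e) = cross (begin
    (a * d + c * b) * (b′ * d)                ≈⟨ D.distribʳ _ _ _ ⟩
    a * d * (b′ * d) + c * b * (b′ * d)       ≈⟨ D.+-cong (interchange a d b′ d) (D.*-congˡ (D.*-comm b′ d)) ⟩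
    a * b′ * (d * d) + c * b * (d * b′)       ≈⟨ D.+-cong (D.*-congʳ e) (interchange c b d b′) ⟩
    a′ * b * (d * d) + c * d * (b * b′)       ≈⟨ D.+-congˡ (D.*-congˡ (D.*-comm b b′)) ⟩
    a′ * b * (d * d) + c * d * (b′ * b)       ≈⟨ D.+-cong (interchange a′ b d d) (interchange c d b′ b) ⟩
    a′ * d * (b * d) + c * b′ * (d * b)       ≈⟨ D.+-congˡ (D.*-congˡ (D.*-comm d b)) ⟩
    a′ * d * (b * d) + c * b′ * (b * d)       ≈⟨ D.distribʳ _ _ _ ⟨
    (a′ * d + c * b′) * (b * d)               ∎)

  ⊞-cong : ∀ {x x′ y y′} → x ≃ x′ → y ≃ y′ → x ⊞ y ≃ x′ ⊞ y′
  ⊞-cong {x} {x′} {y} {y′} e f =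
    ≃-trans (⊞-congʳ {x} {x′} {y} e) (≃-trans (⊞-comm x′ y) (≃-trans (⊞-congʳ {y} {y′} {x′} f) (⊞-comm y′ x′)))

  ⊞-assoc : ∀ x y z → (x ⊞ y) ⊞ z ≃ x ⊞ (y ⊞ z)
  ⊞-assoc (a / b ⟨ _ ⟩) (c / d ⟨ _ ⟩) (e / f ⟨ _ ⟩) = ≃-parts (begin
    (a * d + c * b) * f + e * (b * d)               ≈⟨ D.+-congʳ (D.distribʳ f _ _) ⟩
    (a * d * f + c * b * f) + e * (b * d)           ≈⟨ D.+-assoc _ _ _ ⟩
    a * d * f + (c * b * f + e * (b * d))           ≈⟨ D.+-cong (D.*-assoc a d f) (D.+-cong (xy∙z≈xz∙y c b f) (D.trans (x∙yz≈y∙xz e b d) (D.*-comm b _))) ⟩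
    a * (d * f) + (c * f * b + e * d * b)           ≈⟨ D.+-congˡ (D.distribʳ b _ _) ⟨
    a * (d * f) + (c * f + e * d) * b               ∎)
    (D.*-assoc b d f)

  ⊞-identityˡ : ∀ x → 0F ⊞ x ≃ x
  ⊞-identityˡ (a / b ⟨ _ ⟩) = ≃-parts (begin
    0# * b + a * 1#   ≈⟨ D.+-cong (D.zeroˡ b) (D.*-identityʳ a) ⟩
    0# + a            ≈⟨ D.+-identityˡ a ⟩
    a                 ∎)
    (D.*-identityˡ b)

  num≈0⇒≃0 : ∀ {x} → num x ≈ 0# → x ≃ 0F
  num≈0⇒≃0 {x} e = cross (begin
    num x * 1#   ≈⟨ D.*-identityʳ _ ⟩
    num x        ≈⟨ e ⟩
    0#           ≈⟨ D.zeroˡ _ ⟨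
    0# * den x   ∎)

  ⊟-inverseˡ : ∀ x → ⊟ x ⊞ x ≃ 0F
  ⊟-inverseˡ (a / b ⟨ _ ⟩) = num≈0⇒≃0 (begin
    - a * b + a * b   ≈⟨ D.distribʳ b (- a) a ⟨
    (- a + a) * b     ≈⟨ D.*-congʳ (D.-‿inverseˡ a) ⟩
    0# * b            ≈⟨ D.zeroˡ b ⟩
    0#                ∎)

  ⊟-cong : ∀ {x y} → x ≃ y → ⊟ x ≃ ⊟ y
  ⊟-cong {a / b ⟨ _ ⟩} {c / d ⟨ _ ⟩} (cross e) = cross (begin
    - a * d     ≈⟨ -‿distribˡ-* a d ⟨
    - (a * d)   ≈⟨ D.-‿cong e ⟩
    - (c * b)   ≈⟨ -‿distribˡ-* c b ⟩
    - c * b     ∎)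

  ⊠-comm : ∀ x y → x ⊠ y ≃ y ⊠ x
  ⊠-comm x y = ≃-parts (D.*-comm _ _) (D.*-comm _ _)

  ⊠-distribʳ : ∀ z x y → (x ⊞ y) ⊠ z ≃ x ⊠ z ⊞ y ⊠ z
  ⊠-distribʳ (e / f ⟨ _ ⟩) (a / b ⟨ _ ⟩) (c / d ⟨ _ ⟩) = cross (begin
    (a * d + c * b) * e * (b * f * (d * f))                ≈⟨ D.*-cong (D.distribʳ e _ _) (interchange b f d f) ⟩
    (a * d * e + c * b * e) * (b * d * (f * f))            ≈⟨ D.*-congˡ (D.*-assoc (b * d) f f) ⟨
    (a * d * e + c * b * e) * (b * d * f * f)              ≈⟨ D.*-congˡ (D.*-comm _ f) ⟩
    (a * d * e + c * b * e) * (f * (b * d * f))            ≈⟨ D.*-assoc _ f _ ⟨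
    (a * d * e + c * b * e) * f * (b * d * f)              ≈⟨ D.*-congʳ (D.distribʳ f _ _) ⟩
    (a * d * e * f + c * b * e * f) * (b * d * f)          ≈⟨ D.*-congʳ (D.+-cong (shuffle a d) (shuffle c b)) ⟩
    (a * e * (d * f) + c * e * (b * f)) * (b * d * f)      ∎)
    where
    shuffle : ∀ u v → u * v * e * f ≈ u * e * (v * f)
    shuffle u v = D.trans (D.*-congʳ (xy∙z≈xz∙y u v e)) (D.*-assoc (u * e) v f)

  fractionRing : CommutativeRing 0ℓ 0ℓ
  fractionRing = record
    { Carrier = Fraction
    ; _≈_     = _≃_
    ; _+_     = _⊞_
    ; _*_     = _⊠_
    ; -_      = ⊟_
    ; 0#      = 0F
    ; 1#      = 1F
    ; isCommutativeRing = record
      { isRing = record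
        { +-isAbelianGroup = record
          { isGroup = record
            { isMonoid = record
              { isSemigroup = record
                { isMagma = record { isEquivalence = Setoid.isEquivalence ≃-setoid ; ∙-cong = ⊞-cong }
                ; assoc   = ⊞-assoc
                }
              ; identity = comm∧idˡ⇒id ≃-setoid ⊞-comm {0F} ⊞-identityˡ
              }
            ; inverse = comm∧invˡ⇒inv ≃-setoid {_⁻¹ = ⊟_} {0F} ⊞-comm ⊟-inverseˡ
            ; ⁻¹-cong = ⊟-cong
            }
          ; comm = ⊞-comm
          }
        ; *-cong     = ⊠-cong
        ; *-assoc    = λ x y z → ≃-parts (D.*-assoc _ _ _) (D.*-assoc _ _ _)
        ; *-identity = comm∧idˡ⇒id ≃-setoid ⊠-comm {1F} (λ x → ≃-parts (D.*-identityˡ _) (D.*-identityˡ _))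
        ; distrib    = comm∧distrʳ⇒distr ≃-setoid ⊞-cong ⊠-comm ⊠-distribʳ
        }
      ; *-comm = ⊠-comm
      }
    }

  private
    module Q = CommutativeRing fractionRing
    module QP = RawSemiringOps (rawSemiringOf fractionRing)

  num≉0 : ∀ {x} → ¬ (x ≃ 0F) → num x ≉ 0#
  num≉0 x≄0 e = x≄0 (num≈0⇒≃0 e)

  reciprocal : (x : Fraction) → ¬ (x ≃ 0F) → Fraction
  reciprocal x x≄0 = den x / num x ⟨ num≉0 x≄0 ⟩

  reciprocalˡ : ∀ x x≄0 → reciprocal x x≄0 ⊠ x ≃ 1F
  reciprocalˡ x x≄0 = cross (D.trans (D.*-identityʳ _) (D.trans (D.*-comm _ _) (D.sym (D.*-identityˡ _))))

  embed-cong⁻¹ : ∀ {a b} → embed a ≃ embed b → a ≈ b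
  embed-cong⁻¹ (cross e) = D.trans (D.sym (D.*-identityʳ _)) (D.trans e (D.*-identityʳ _))

  embed-× : ∀ n → n QP.× 1F ≃ embed (n D.× 1#)
  embed-× zero    = Q.refl
  embed-× (suc n) = Q.trans (Q.+-congˡ {1F} (embed-× n))
    (≃-parts (D.+-cong (D.*-identityʳ _) (D.*-identityʳ _)) (D.*-identityˡ _))

  embed-^ : ∀ a n → embed a QP.^ n ≃ embed (a D.^ n)
  embed-^ a zero    = Q.refl
  embed-^ a (suc n) = Q.trans (Q.*-congˡ {embed a} (embed-^ a n)) (≃-parts D.refl (D.*-identityˡ _))

  ≃-decSetoid : DecSetoid 0ℓ 0ℓ
  ≃-decSetoid = record { isDecEquivalence = record { isEquivalence = Q.isEquivalence ; _≟_ = _≃?_ } }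

  fractionField : Field₀
  fractionField = record
    { heytingField = record
      { isHeytingField = record
        { isHeytingCommutativeRing = record
          { isCommutativeRing   = Q.isCommutativeRing
          ; isApartnessRelation = ≉-isApartnessRelation
          ; #⇒invertible        = λ {x} {y} x≄y →
              let x-y≄0 = λ e → x≄y (GroupProperties.x∙y⁻¹≈ε⇒x≈y Q.+-group x y e)
                  inv   = reciprocalˡ (x Q.- y) x-y≄0
              in reciprocal (x Q.- y) x-y≄0 , inv , Q.trans (Q.*-comm (x Q.- y) (reciprocal (x Q.- y) x-y≄0)) inv
          ; invertible⇒#        = λ {x} {y} (z , _ , inv) x≃y → D.1≉0 (embed-cong⁻¹
              (Q.trans (Q.sym inv) (Q.trans (Q.*-congʳ {z} {x Q.- y} {0F} (GroupProperties.x≈y⇒x∙y⁻¹≈ε Q.+-group {x} {y} x≃y)) (Q.zeroˡ z))))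
          }
        ; tight = ≉-tight
        }
      }
    ; charZero = λ n e → D.charZero n (embed-cong⁻¹ (Q.trans (Q.sym (embed-× n)) e))
    }
    where open DecSetoidProperties ≃-decSetoid

  parameter : (a : A) → (∀ n .{{_ : NonZero n}} → ¬ (1# ≈ a D.^ n)) → Parameter fractionField
  parameter a 1≉aⁿ = record
    { val   = embed a
    ; 1#val = λ n e → 1≉aⁿ n (embed-cong⁻¹ (Q.trans e (embed-^ a n)))
    }

module ℚ[t]    = Polynomial ℚ-domain
module ℚ[t][s] = Polynomial ℚ[t].polynomialDomain

ℚ⟨t⟩ : Field₀
ℚ⟨t⟩ = Fractions.fractionField ℚ[t].polynomialDomain

t₀ : Parameter ℚ⟨t⟩
t₀ = Fractions.parameter ℚ[t].polynomialDomain ℚ[t].X ℚ[t].1≉X^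

ℚ⟨t,s⟩ : Field₀
ℚ⟨t,s⟩ = Fractions.fractionField ℚ[t][s].polynomialDomain

-- In ℚ(t,s) = Frac ℚ[t][s], t is a constant polynomial
-- over ℚ[t], s is the variable.
t s : Parameter ℚ⟨t,s⟩
t = Fractions.parameter ℚ[t][s].polynomialDomain (ℚ[t][s].C ℚ[t].X)
      (λ n → ℚ[t][s].1≉C^ n (ℚ[t].1≉X^ n))
s = Fractions.parameter ℚ[t][s].polynomialDomain ℚ[t][s].X ℚ[t][s].1≉X^

module Sums (R : RawSemiring 0ℓ 0ℓ) where
  open RawSemiring R
  open RawSemiringOps R using (sum)

  infixl 10 sumFromTo
  sumFromTo : ℕ → ℕ → (ℕ → Carrier) → Carrier
  sumFromTo a b f = sum {suc b ∸ a} (λ i → f (a ℕ.+ toℕ i))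

  syntax sumFromTo a b (λ k → x) = ∑[ k ∈ a ⋯ b ] x

-- The series Σₙ (f n) zⁿ with coefficients in R, represented by f.
module PowerSeries (R : RawSemiring 0ℓ 0ℓ) where
  open RawSemiring R
  open Sums R

  seriesSemiring : RawSemiring 0ℓ 0ℓ
  seriesSemiring = record
    { Carrier = ℕ → Carrier
    ; _≈_     = λ f g → ∀ n → f n ≈ g n
    ; _+_     = λ f g n → f n + g n
    ; _*_     = λ f g n → ∑[ k ∈ 0 ⋯ n ] (f k * g (n ∸ k))
    ; 0#      = λ _ → 0#
    ; 1#      = λ { zero → 1# ; (suc _) → 0# }
    }

  -- Σₖ (c k) z²ᵏ⁺¹
  oddSeries : (ℕ → Carrier) → ℕ → Carrier
  oddSeries c zero          = 0#
  oddSeries c (suc zero)    = c 0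
  oddSeries c (suc (suc n)) = oddSeries (c ∘ suc) n

odd : ℕ → ℕ
odd k = suc (2 ℕ.* k)

-- R is an algebra over F, with scalar multiplication _•_.
module Exponential (F : Field₀) (R : RawSemiring 0ℓ 0ℓ)
  (_•_ : Field₀.Carrier F → RawSemiring.Carrier R → RawSemiring.Carrier R) where
  open Field₀ F using (1/)
  open Sums R
  open PowerSeries R using (seriesSemiring)
  open RawSemiringOps seriesSemiring using (_^_)

  -- Only for series f without constant term: then fᵏ has no term of degree
  -- below k, so that the coefficient of zⁿ in Σₖ fᵏ/k! is the finite sum below.
  exp : (ℕ → RawSemiring.Carrier R) → (ℕ → RawSemiring.Carrier R)
  exp f n = ∑[ k ∈ 0 ⋯ n ] (1/ (k !) {{k ℕₚ.!≢0}} • (f ^ k) n)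

module Fock (F : Field₀) where
  private module K = Field₀ F
  open K using (0#; 1#; _+_; _*_; -_; _-_; 1/; 1/[_]) renaming (Carrier to K)

  infixl 6 _⊕_
  infixl 7 _⊗_ _•_
  infix  4 _≋_

  -- The polynomial ring K[p₁,p₃,p₅,…], presented as the free commutative
  -- K-algebra on the generators p k, where p k stands for p₂ₖ₊₁.
  data Γ : Set where
    con : K → Γ
    p   : ℕ → Γ
    _⊕_ : Γ → Γ → Γ
    _⊗_ : Γ → Γ → Γ

  data _≋_ : Γ → Γ → Set where
    ≋-refl      : ∀ {f} → f ≋ f
    ≋-sym       : ∀ {f g} → f ≋ g → g ≋ f
    ≋-trans     : ∀ {f g h} → f ≋ g → g ≋ h → f ≋ h
    con-cong    : ∀ {a b} → a K.≈ b → con a ≋ con b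
    ⊕-cong      : ∀ {f f′ g g′} → f ≋ f′ → g ≋ g′ → f ⊕ g ≋ f′ ⊕ g′
    ⊗-cong      : ∀ {f f′ g g′} → f ≋ f′ → g ≋ g′ → f ⊗ g ≋ f′ ⊗ g′
    con-+       : ∀ a b → con (a + b) ≋ con a ⊕ con b
    con-*       : ∀ a b → con (a * b) ≋ con a ⊗ con b
    ⊕-assoc     : ∀ f g h → (f ⊕ g) ⊕ h ≋ f ⊕ (g ⊕ h)
    ⊕-comm      : ∀ f g → f ⊕ g ≋ g ⊕ f
    ⊕-identityˡ : ∀ f → con 0# ⊕ f ≋ f
    ⊗-assoc     : ∀ f g h → (f ⊗ g) ⊗ h ≋ f ⊗ (g ⊗ h)
    ⊗-comm      : ∀ f g → f ⊗ g ≋ g ⊗ f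
    ⊗-identityˡ : ∀ f → con 1# ⊗ f ≋ f
    ⊗-zeroˡ     : ∀ f → con 0# ⊗ f ≋ con 0#
    ⊗-distribʳ  : ∀ h f g → (f ⊕ g) ⊗ h ≋ f ⊗ h ⊕ g ⊗ h

  𝟎 𝟏 : Γ
  𝟎 = con 0#
  𝟏 = con 1#

  _•_ : K → Γ → Γ
  c • f = con c ⊗ f

  ≋-setoid : Setoid 0ℓ 0ℓ
  ≋-setoid = record
    { Carrier       = Γ
    ; _≈_           = _≋_
    ; isEquivalence = record { refl = ≋-refl ; sym = ≋-sym ; trans = ≋-trans }
    }

  Γ-commutativeRing : CommutativeRing 0ℓ 0ℓ
  Γ-commutativeRing = record
    { Carrier = Γ
    ; _≈_     = _≋_
    ; _+_     = _⊕_
    ; _*_     = _⊗_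
    ; -_      = (- 1#) •_
    ; 0#      = 𝟎
    ; 1#      = 𝟏
    ; isCommutativeRing = record
      { isRing = record
        { +-isAbelianGroup = record
          { isGroup = record
            { isMonoid = record
              { isSemigroup = record
                { isMagma = record { isEquivalence = Setoid.isEquivalence ≋-setoid ; ∙-cong = ⊕-cong }
                ; assoc   = ⊕-assoc
                }
              ; identity = comm∧idˡ⇒id ≋-setoid ⊕-comm ⊕-identityˡ
              }
            ; inverse = comm∧invˡ⇒inv ≋-setoid ⊕-comm inverseˡ
            ; ⁻¹-cong = ⊗-cong ≋-refl
            }
          ; comm = ⊕-comm
          }
        ; *-cong     = ⊗-cong
        ; *-assoc    = ⊗-assoc
        ; *-identity = comm∧idˡ⇒id ≋-setoid ⊗-comm ⊗-identityˡ
        ; distrib    = comm∧distrʳ⇒distr ≋-setoid ⊕-cong ⊗-comm ⊗-distribʳ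
        }
      ; *-comm = ⊗-comm
      }
    }
    where
    open SetoidReasoning ≋-setoid
    inverseˡ : ∀ f → (- 1#) • f ⊕ f ≋ 𝟎
    inverseˡ f = begin
      con (- 1#) ⊗ f ⊕ f            ≈⟨ ⊕-cong ≋-refl (⊗-identityˡ f) ⟨
      con (- 1#) ⊗ f ⊕ con 1# ⊗ f   ≈⟨ ⊗-distribʳ f _ _ ⟨
      (con (- 1#) ⊕ con 1#) ⊗ f     ≈⟨ ⊗-cong (con-+ _ _) ≋-refl ⟨
      con (- 1# + 1#) ⊗ f           ≈⟨ ⊗-cong (con-cong (K.-‿inverseˡ 1#)) ≋-refl ⟩
      con 0# ⊗ f                    ≈⟨ ⊗-zeroˡ f ⟩
      𝟎                             ∎

  Γ-rawSemiring : RawSemiring 0ℓ 0ℓ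
  Γ-rawSemiring = rawSemiringOf Γ-commutativeRing

  open Sums Γ-rawSemiring public

  -- Operators on Γ, multiplied by composition.
  Op : Set
  Op = Γ → Γ

  Op-rawSemiring : RawSemiring 0ℓ 0ℓ
  Op-rawSemiring = record
    { Carrier = Op
    ; _≈_     = λ S T → ∀ f → S f ≋ T f
    ; _+_     = λ S T f → S f ⊕ T f
    ; _*_     = λ S T → S ∘ T
    ; 0#      = const 𝟎
    ; 1#      = id
    }

  _•ᵒ_ : K → Op → Op
  (c •ᵒ T) f = c • T f

  -- ∂ k = ∂/∂p₂ₖ₊₁
  ∂ : ℕ → Op
  ∂ k (con c) = 𝟎
  ∂ k (f ⊕ g) = ∂ k f ⊕ ∂ k g
  ∂ k (f ⊗ g) = ∂ k f ⊗ g ⊕ f ⊗ ∂ k g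
  ∂ k (p j) with k ℕₚ.≟ j
  ... | yes _ = 𝟏
  ... | no  _ = 𝟎

  fromℕ : ℕ → K
  fromℕ n = n K.× 1#

  [-1]^_ : ℕ → K
  [-1]^ k = (- 1#) K.^ k

  -- creation k = a₋ₙ and annihilation k = aₙ for n = 2k+1.
  creation annihilation : ℕ → Op
  creation k f = p k ⊗ f
  annihilation k f = (fromℕ (odd k) * 1/ 2) • ∂ k f

  module ExpK  = Exponential F K.rawSemiring _*_
  module ExpΓ  = Exponential F Γ-rawSemiring _•_
  module ExpOp = Exponential F Op-rawSemiring _•ᵒ_
  module SerK  = PowerSeries K.rawSemiring
  module SerΓ  = PowerSeries Γ-rawSemiring
  module SerOp = PowerSeries Op-rawSemiring

  1-_^_ : Parameter F → ℕ → K
  1- t ^ n = 1# - Parameter.val t K.^ n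

  1/[1-_^_] : Parameter F → (n : ℕ) .{{_ : NonZero n}} → K
  1/[1- t ^ n ] = 1/[ Parameter.1#val t n ]

  2/ : (n : ℕ) .{{_ : NonZero n}} → K
  2/ n = fromℕ 2 * 1/ n

  -- raising t i is the coefficient of zⁱ in the left exponential of 𝒴(z;t),
  -- lowering t j that of z⁻ʲ in the right one.
  raising lowering : Parameter F → ℕ → Op
  raising  t = ExpOp.exp (SerOp.oddSeries λ k → (2/ (odd k) * 1- t ^ odd k) •ᵒ creation k)
  lowering t = ExpOp.exp (SerOp.oddSeries λ k → (- (2/ (odd k) * 1/[1- t ^ odd k ])) •ᵒ annihilation k)

  raisingℤ : Parameter F → ℤ → Op
  raisingℤ t (+ i)      = raising t i
  raisingℤ t (-[1+ _ ]) = const 𝟎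

  -- An upper bound for the degree of f, where pₙ has degree n.
  degree : Γ → ℕ
  degree (con c) = 0
  degree (p k)   = odd k
  degree (f ⊕ g) = degree f ⊔ degree g
  degree (f ⊗ g) = degree f ℕ.+ degree g

  -- The coefficient of z⁻ᵐ in 𝒴(z;t) is Σⱼ raisingⱼ₋ₘ ∘ loweringⱼ over all j ≥ 0.
  -- Applied to f, the terms with j > degree f vanish (lowering-vanishes).
  𝒴 : Parameter F → ℤ → Op
  𝒴 t m f = ∑[ j ∈ 0 ⋯ degree f ] raisingℤ t (+ j ℤ.- m) (lowering t j f)

  -- q t r = qᵣ(X;t)
  q : Parameter F → ℕ → Γ
  q t = ExpΓ.exp (SerΓ.oddSeries λ k → (2/ (odd k) * 1- t ^ odd k) • p k)

  -- 𝒬 t s r m = 𝒬ᵣₘ with parameters t, s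
  𝒬 : Parameter F → Parameter F → ℕ → ℕ → Γ
  𝒬 t s r m = 𝒴 t (ℤ.- (+ r)) (𝒴 s (ℤ.- (+ m)) 𝟏)

  -- f t s k = fₖ(t,s)
  f : Parameter F → Parameter F → ℕ → K
  f t s = ExpK.exp (SerK.oddSeries λ k → - (2/ (odd k) * (1- s ^ odd k * 1/[1- t ^ odd k ])))

  private
    module R = CommutativeRing Γ-commutativeRing
    open SetoidReasoning ≋-setoid
    open CommutativeSemigroupProperties R.+-commutativeSemigroup using () renaming (interchange to ⊕-interchange)
    open RawSemiringOps Op-rawSemiring using () renaming (sum to sumOp)
    open RawSemiringOps SerOp.seriesSemiring using () renaming (_^_ to _^ᵒ_)

  ∂-cong : ∀ k {f g} → f ≋ g → ∂ k f ≋ ∂ k g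
  ∂-cong k ≋-refl = ≋-refl
  ∂-cong k (≋-sym e) = ≋-sym (∂-cong k e)
  ∂-cong k (≋-trans d e) = ≋-trans (∂-cong k d) (∂-cong k e)
  ∂-cong k (con-cong e) = ≋-refl
  ∂-cong k (⊕-cong d e) = ⊕-cong (∂-cong k d) (∂-cong k e)
  ∂-cong k (⊗-cong d e) = ⊕-cong (⊗-cong (∂-cong k d) e) (⊗-cong d (∂-cong k e))
  ∂-cong k (con-+ a b) = ≋-sym (⊕-identityˡ 𝟎)
  ∂-cong k (con-* a b) = ≋-sym (≋-trans (⊕-cong (⊗-zeroˡ (con b)) (R.zeroʳ (con a))) (⊕-identityˡ 𝟎))
  ∂-cong k (⊕-assoc f g h) = ⊕-assoc _ _ _
  ∂-cong k (⊕-comm f g) = ⊕-comm _ _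
  ∂-cong k (⊕-identityˡ f) = ⊕-identityˡ _
  ∂-cong k (⊗-assoc f g h) = begin
    (∂ k f ⊗ g ⊕ f ⊗ ∂ k g) ⊗ h ⊕ (f ⊗ g) ⊗ ∂ k h           ≈⟨ ⊕-cong (⊗-distribʳ h _ _) (⊗-assoc f g _) ⟩
    (∂ k f ⊗ g ⊗ h ⊕ f ⊗ ∂ k g ⊗ h) ⊕ f ⊗ (g ⊗ ∂ k h)       ≈⟨ ⊕-assoc _ _ _ ⟩
    ∂ k f ⊗ g ⊗ h ⊕ (f ⊗ ∂ k g ⊗ h ⊕ f ⊗ (g ⊗ ∂ k h))       ≈⟨ ⊕-cong (⊗-assoc _ g h) (⊕-cong (⊗-assoc f _ h) ≋-refl) ⟩
    ∂ k f ⊗ (g ⊗ h) ⊕ (f ⊗ (∂ k g ⊗ h) ⊕ f ⊗ (g ⊗ ∂ k h))   ≈⟨ ⊕-cong ≋-refl (R.distribˡ f _ _) ⟨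
    ∂ k f ⊗ (g ⊗ h) ⊕ f ⊗ (∂ k g ⊗ h ⊕ g ⊗ ∂ k h)           ∎
  ∂-cong k (⊗-comm f g) = begin
    ∂ k f ⊗ g ⊕ f ⊗ ∂ k g   ≈⟨ ⊕-comm _ _ ⟩
    f ⊗ ∂ k g ⊕ ∂ k f ⊗ g   ≈⟨ ⊕-cong (⊗-comm f _) (⊗-comm _ g) ⟩
    ∂ k g ⊗ f ⊕ g ⊗ ∂ k f   ∎
  ∂-cong k (⊗-identityˡ f) = begin
    𝟎 ⊗ f ⊕ 𝟏 ⊗ ∂ k f   ≈⟨ ⊕-cong (⊗-zeroˡ f) (⊗-identityˡ _) ⟩
    𝟎 ⊕ ∂ k f           ≈⟨ ⊕-identityˡ _ ⟩
    ∂ k f               ∎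
  ∂-cong k (⊗-zeroˡ f) = begin
    𝟎 ⊗ f ⊕ 𝟎 ⊗ ∂ k f   ≈⟨ ⊕-cong (⊗-zeroˡ f) (⊗-zeroˡ _) ⟩
    𝟎 ⊕ 𝟎               ≈⟨ ⊕-identityˡ 𝟎 ⟩
    𝟎                   ∎
  ∂-cong k (⊗-distribʳ h f g) = begin
    (∂ k f ⊕ ∂ k g) ⊗ h ⊕ (f ⊕ g) ⊗ ∂ k h                       ≈⟨ ⊕-cong (⊗-distribʳ h _ _) (⊗-distribʳ _ f g) ⟩
    (∂ k f ⊗ h ⊕ ∂ k g ⊗ h) ⊕ (f ⊗ ∂ k h ⊕ g ⊗ ∂ k h)           ≈⟨ ⊕-interchange _ _ _ _ ⟩
    (∂ k f ⊗ h ⊕ f ⊗ ∂ k h) ⊕ (∂ k g ⊗ h ⊕ g ⊗ ∂ k h)           ∎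

  -- f has degree < n; in particular Degree< 0 f means f ≋ 𝟎.
  data Degree< : ℕ → Γ → Set where
    null : ∀ {n f} → f ≋ 𝟎 → Degree< n f
    con  : ∀ {n c} → Degree< (suc n) (con c)
    var  : ∀ {n k} → odd k ℕ.< n → Degree< n (p k)
    add  : ∀ {n f g} → Degree< n f → Degree< n g → Degree< n (f ⊕ g)
    mul  : ∀ {l m n f g} → Degree< (suc m) f → Degree< (suc n) g → m ℕ.+ n ℕ.< l → Degree< l (f ⊗ g)

  Degree<0⇒≋𝟎 : ∀ {f} → Degree< 0 f → f ≋ 𝟎
  Degree<0⇒≋𝟎 (null e)  = e
  Degree<0⇒≋𝟎 (add d e) = ≋-trans (⊕-cong (Degree<0⇒≋𝟎 d) (Degree<0⇒≋𝟎 e)) (⊕-identityˡ 𝟎)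

  Degree<-weaken : ∀ {m n f} → m ℕ.≤ n → Degree< m f → Degree< n f
  Degree<-weaken m≤n       (null e)    = null e
  Degree<-weaken (s≤s m≤n) con         = con
  Degree<-weaken m≤n       (var k<m)   = var (ℕₚ.<-≤-trans k<m m≤n)
  Degree<-weaken m≤n       (add d e)   = add (Degree<-weaken m≤n d) (Degree<-weaken m≤n e)
  Degree<-weaken m≤n       (mul d e l) = mul d e (ℕₚ.<-≤-trans l m≤n)

  Degree<-mulˡ : ∀ l {m n f g} → Degree< m f → Degree< (suc n) g → (0 ℕ.< m → m ℕ.+ n ℕ.≤ l) → Degree< l (f ⊗ g)
  Degree<-mulˡ l {zero}  {g = g} d e _ = null (≋-trans (⊗-cong (Degree<0⇒≋𝟎 d) ≋-refl) (⊗-zeroˡ g))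
  Degree<-mulˡ l {suc m} d e m+n<l = mul d e (m+n<l (s≤s z≤n))

  Degree<-mulʳ : ∀ l {m n f g} → Degree< (suc m) f → Degree< n g → (0 ℕ.< n → m ℕ.+ n ℕ.≤ l) → Degree< l (f ⊗ g)
  Degree<-mulʳ l {n = zero}  {f = f} d e _ = null (≋-trans (⊗-cong ≋-refl (Degree<0⇒≋𝟎 e)) (R.zeroʳ f))
  Degree<-mulʳ l {m} {suc n} d e m+n≤l = mul d e (≡.subst (ℕ._≤ l) (ℕₚ.+-suc m n) (m+n≤l (s≤s z≤n)))

  Degree<-• : ∀ {n f} c → Degree< n f → Degree< n (c • f)
  Degree<-• {n} c d = Degree<-mulʳ n (con {0}) d (λ _ → ℕₚ.≤-refl)

  degree-bound : ∀ f → Degree< (suc (degree f)) f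
  degree-bound (con c) = con
  degree-bound (p k)   = var ℕₚ.≤-refl
  degree-bound (f ⊕ g) = add
    (Degree<-weaken (s≤s (ℕₚ.m≤m⊔n (degree f) (degree g))) (degree-bound f))
    (Degree<-weaken (s≤s (ℕₚ.m≤n⊔m (degree f) (degree g))) (degree-bound g))
  degree-bound (f ⊗ g) = mul (degree-bound f) (degree-bound g) ℕₚ.≤-refl

  record Lowers (j : ℕ) (T : Op) : Set where
    constructor lowers
    field lower : ∀ {n f} → Degree< n f → Degree< (n ∸ j) (T f)
  open Lowers

  ∂-lowers : ∀ k {n f} → Degree< n f → Degree< (n ∸ odd k) (∂ k f)
  ∂-lowers k (null e) = null (∂-cong k e)
  ∂-lowers k con      = null ≋-refl
  ∂-lowers k {n} (var {k = j} j<n) with k ℕₚ.≟ j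
  ... | yes ≡.refl = Degree<-weaken (ℕₚ.m<n⇒0<n∸m j<n) (con {0})
  ... | no _       = null ≋-refl
  ∂-lowers k (add d e) = add (∂-lowers k d) (∂-lowers k e)
  ∂-lowers k {l} (mul {m = m} {n} d e m+n<l) = add
    (Degree<-mulˡ (l ∸ odd k) (∂-lowers k d) e λ 0<m+1-o →
      ≡.subst (ℕ._≤ l ∸ odd k) (ℕₚ.+-∸-comm {suc m} n (ℕₚ.<⇒≤ (ℕₚ.m∸n≢0⇒n<m {suc m} {odd k} (ℕₚ.n>0⇒n≢0 0<m+1-o))))
        (ℕₚ.∸-monoˡ-≤ (odd k) m+n<l))
    (Degree<-mulʳ (l ∸ odd k) d (∂-lowers k e) λ 0<n+1-o →
      ≡.subst (ℕ._≤ l ∸ odd k) (ℕₚ.+-∸-assoc m {suc n} (ℕₚ.<⇒≤ (ℕₚ.m∸n≢0⇒n<m {suc n} {odd k} (ℕₚ.n>0⇒n≢0 0<n+1-o))))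
        (ℕₚ.∸-monoˡ-≤ (odd k) (≡.subst (ℕ._≤ l) (≡.sym (ℕₚ.+-suc m n)) m+n<l)))

  sum-lowers : ∀ {j} n (T : Fin n → Op) → (∀ i → Lowers j (T i)) → Lowers j (sumOp T)
  sum-lowers zero    T low = lowers λ _ → null ≋-refl
  sum-lowers (suc n) T low = lowers λ d → add (lower (low zero) d) (lower (sum-lowers n (T ∘ suc) (low ∘ suc)) d)

  id-lowers : Lowers 0 id
  id-lowers = lowers λ d → d

  ∘-lowers : ∀ {i j S T} → i ℕ.≤ j → Lowers i S → Lowers (j ∸ i) T → Lowers j (S ∘ T)
  ∘-lowers {i} {j} {S} {T} i≤j S-low T-low = lowers λ {n} {f} d →
    ≡.subst (λ m → Degree< m (S (T f)))
      (≡.trans (ℕₚ.∸-+-assoc n (j ∸ i) i) (≡.cong (n ∸_) (ℕₚ.m∸n+n≡m i≤j)))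
      (lower S-low (lower T-low d))

  ^-lowers : ∀ {L : ℕ → Op} → (∀ n → Lowers n (L n)) → ∀ k n → Lowers n ((L ^ᵒ k) n)
  ^-lowers low zero    zero    = id-lowers
  ^-lowers low zero    (suc n) = lowers λ _ → null ≋-refl
  ^-lowers low (suc k) n       = sum-lowers (suc n) _ λ i →
    ∘-lowers (toℕ≤pred[n] i) (low (toℕ i)) (^-lowers low k (n ∸ toℕ i))

  exp-lowers : ∀ {L : ℕ → Op} → (∀ n → Lowers n (L n)) → ∀ n → Lowers n (ExpOp.exp L n)
  exp-lowers low n = sum-lowers (suc n) _ λ i → lowers λ d → Degree<-• (1/ (toℕ i !) {{toℕ i ℕₚ.!≢0}}) (lower (^-lowers low (toℕ i) n) d)

  oddSeries-lowers : ∀ o {c : ℕ → Op} → (∀ k → Lowers (o ℕ.+ odd k) (c k)) →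
                     ∀ n → Lowers (o ℕ.+ n) (SerOp.oddSeries c n)
  oddSeries-lowers o low zero          = lowers λ _ → null ≋-refl
  oddSeries-lowers o low (suc zero)    = low 0
  oddSeries-lowers o {c} low (suc (suc n)) = ≡.subst (λ m → Lowers m (SerOp.oddSeries (c ∘ suc) n))
    (shift n) (oddSeries-lowers (2 ℕ.+ o) (λ k → ≡.subst (λ m → Lowers m (c (suc k)))
      (≡.trans (≡.cong (λ m → o ℕ.+ suc m) (ℕₚ.*-suc 2 k)) (≡.sym (shift (odd k)))) (low (suc k))) n)
    where
    shift : ∀ n → 2 ℕ.+ o ℕ.+ n ≡ o ℕ.+ (2 ℕ.+ n)
    shift n = ≡.sym (≡.trans (ℕₚ.+-suc o (suc n)) (≡.cong suc (ℕₚ.+-suc o n)))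

  lowering-lowers : ∀ t j → Lowers j (lowering t j)
  lowering-lowers t = exp-lowers (oddSeries-lowers 0 λ k → lowers λ d → Degree<-• _ (Degree<-• _ (∂-lowers k d)))

  lowering-vanishes : ∀ t j f → degree f ℕ.< j → lowering t j f ≋ 𝟎
  lowering-vanishes t j f deg<j = Degree<0⇒≋𝟎
    (≡.subst (λ n → Degree< n (lowering t j f)) (ℕₚ.m≤n⇒m∸n≡0 deg<j) (lower (lowering-lowers t j) (degree-bound f)))

{-# OPTIONS --safe #-}
module Submission where

-- The proof commutes the annihilation half of 𝒴(z;t) past 𝒴(w;s)𝟏. Write
-- q(w;s) = Σ qₘ(X;s) wᵐ = 𝒴(w;s)𝟏 (𝒴-𝟏).
--
-- The exponential of an operator series that acts on some vectors by a scalar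
-- series acts on them by the exponential of that scalar series (acts-exp). This
-- is used for both halves of 𝒴(z;t). The creation half is multiplication by
-- q(z;t) (raising≋q⊗). For the annihilation half, every ∂/∂pₙ is a derivation,
-- hence by the chain rule for the exponential (D-exp)
--   ∂/∂pₙ q(w;s) = (2(1 - sⁿ)/n) wⁿ q(w;s),
-- so q(w;s) is an eigenvector of all aₙ. The exponent of the annihilation half
-- then acts on it by the scalar series -2 Σ (1 - sⁿ)/(1 - tⁿ) uⁿ/n with u = w/z,
-- and the annihilation half by Σ fₖ(t,s) uᵏ (lowering-q). The coefficient of
-- zʳ wᵐ in the product of Σ fₖ(t,s) uᵏ, q(z;t) and q(w;s) is the claimed sum over
-- k ≤ m. The sum that defines 𝒴 runs up to a degree bound instead of m, but all
-- terms beyond either bound vanish (∑-truncate, 𝒬-expansion).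
--
-- For s = t the series f has the exponent -2(u + u³/3 + u⁵/5 + ⋯), which is
-- log((1 - u)/(1 + u)). Its coefficients follow from the chain rule for the
-- derivation u d/du, as a recurrence with the solution 2(-1)ⁿ for n ≥ 1 (f-same).

open import Defs
open import Data.Nat.Base using (ℕ; _+_; _∸_)
open import Data.Product.Base using (_×_)

open import Level using (0ℓ)
open import Algebra.Bundles using (CommutativeRing; RawSemiring)
open import Algebra.Morphism.Structures using (module SemiringMorphisms)
import Algebra.Morphism.Construct.Identity as Identity
import Algebra.Definitions.RawSemiring as RawSemiringOps
import Algebra.Properties.CommutativeMonoid.Mult as CommutativeMonoidMult
import Algebra.Properties.CommutativeSemigroup as CommutativeSemigroupProperties
import Algebra.Properties.Ring as RingProperties
import Algebra.Properties.Semiring.Mult as SemiringMult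
import Algebra.Properties.Semiring.Sum as SemiringSum
open import Data.Fin.Base using (Fin; zero; suc; toℕ)
open import Data.Fin.Properties using (toℕ≤pred[n])
open import Data.Integer.Base as ℤ using (+_)
import Data.Integer.Properties as ℤₚ
open import Data.Nat.Base using (zero; suc; NonZero; _≤_; _<_; z≤n; s≤s; _!)
import Data.Nat.Properties as ℕₚ
open import Data.Product.Base using (_,_; proj₂)
open import Function.Base using (_∘_; id; const)
open import Relation.Binary.PropositionalEquality as ≡ using (_≡_; _≢_)
import Relation.Binary.Reasoning.Setoid as SetoidReasoning
open import Relation.Nullary using (yes; no; contradiction)

-- Convolution of power series

module Convolution (R : CommutativeRing 0ℓ 0ℓ) where
  open CommutativeRing R hiding (zero) renaming (_+_ to _⊹_)
  open PowerSeries (rawSemiringOf R) using (seriesSemiring; oddSeries) public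
  open Sums (rawSemiringOf R) public
  open SemiringSum semiring public using (sum; sum-cong-≋; sum-replicate-zero; ∑-distrib-+; *-distribˡ-sum)
  open SetoidReasoning setoid
  open RawSemiringOps seriesSemiring using () renaming (_^_ to _⋆^_) public
  open RawSemiring seriesSemiring using () renaming (Carrier to Series; _*_ to _⋆_; 1# to 𝟙) public

  -- Coefficientwise equality of series.
  infix 4 _≐_
  _≐_ : Series → Series → Set
  f ≐ g = ∀ n → f n ≈ g n

  sum-zero : ∀ {n} (x : Fin n → Carrier) → (∀ i → x i ≈ 0#) → sum x ≈ 0#
  sum-zero {n} x x≈0 = trans (sum-cong-≋ x≈0) (sum-replicate-zero n)

  -- A sum over all of ℕ with finitely many non-zero terms does not depend on
  -- where it is cut off.
  ∑-truncate : ∀ a b (x : Series) → (∀ i → a < i → x i ≈ 0#) → (∀ i → b < i → x i ≈ 0#) →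
               ∑[ i ∈ 0 ⋯ a ] x i ≈ ∑[ i ∈ 0 ⋯ b ] x i
  ∑-truncate zero    zero    x p q = refl
  ∑-truncate zero    (suc b) x p q = +-congˡ (sym (sum-zero {suc b} _ λ i → p (suc (toℕ i)) (s≤s z≤n)))
  ∑-truncate (suc a) zero    x p q = +-congˡ (sum-zero {suc a} _ λ i → q (suc (toℕ i)) (s≤s z≤n))
  ∑-truncate (suc a) (suc b) x p q = +-congˡ (∑-truncate a b (x ∘ suc) (λ i → p (suc i) ∘ s≤s) (λ i → q (suc i) ∘ s≤s))

  ∑-cong : ∀ n {x y : Series} → (∀ i → i ≤ n → x i ≈ y i) → ∑[ i ∈ 0 ⋯ n ] x i ≈ ∑[ i ∈ 0 ⋯ n ] y i
  ∑-cong n {x} {y} x≈y = sum-cong-≋ {suc n} {λ i → x (toℕ i)} {λ i → y (toℕ i)} λ i → x≈y (toℕ i) (toℕ≤pred[n] i)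

  ⋆-cong-≤ : ∀ {f f′ g g′} n → (∀ i → i ≤ n → f i ≈ f′ i) → (∀ i → i ≤ n → g i ≈ g′ i) → (f ⋆ g) n ≈ (f′ ⋆ g′) n
  ⋆-cong-≤ zero    p q = +-congʳ (*-cong (p 0 z≤n) (q 0 z≤n))
  ⋆-cong-≤ (suc n) p q = +-cong (*-cong (p 0 z≤n) (q _ ℕₚ.≤-refl))
    (⋆-cong-≤ n (λ i → p _ ∘ s≤s) (λ i i≤n → q i (ℕₚ.m≤n⇒m≤1+n i≤n)))

  ⋆-cong : ∀ {f f′ g g′} → f ≐ f′ → g ≐ g′ → f ⋆ g ≐ f′ ⋆ g′
  ⋆-cong p q n = ⋆-cong-≤ n (λ i _ → p i) (λ i _ → q i)

  ⋆-zeroʳ : ∀ f n → (f ⋆ const 0#) n ≈ 0#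
  ⋆-zeroʳ f zero    = trans (+-identityʳ _) (zeroʳ _)
  ⋆-zeroʳ f (suc n) = trans (+-cong (zeroʳ _) (⋆-zeroʳ (f ∘ suc) n)) (+-identityˡ 0#)

  ⋆-distribʳ : ∀ h f g n → ((λ i → f i ⊹ g i) ⋆ h) n ≈ (f ⋆ h) n ⊹ (g ⋆ h) n
  ⋆-distribʳ h f g n = trans
    (∑-cong n λ i _ → distribʳ (h (n ∸ i)) (f i) (g i))
    (∑-distrib-+ {suc n} (λ i → f (toℕ i) * h (n ∸ toℕ i)) (λ i → g (toℕ i) * h (n ∸ toℕ i)))

  ⋆-scaleˡ : ∀ a f g n → ((λ i → a * f i) ⋆ g) n ≈ a * (f ⋆ g) n
  ⋆-scaleˡ a f g n = trans
    (∑-cong n λ i _ → *-assoc a (f i) (g (n ∸ i)))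
    (sym (*-distribˡ-sum {suc n} a (λ i → f (toℕ i) * g (n ∸ toℕ i))))

  ⋆-assoc : ∀ f g h → (f ⋆ g) ⋆ h ≐ f ⋆ (g ⋆ h)
  ⋆-assoc f g h zero = +-congʳ (begin
    (f 0 * g 0 ⊹ 0#) * h 0   ≈⟨ *-congʳ (+-identityʳ _) ⟩
    f 0 * g 0 * h 0          ≈⟨ *-assoc _ _ _ ⟩
    f 0 * (g 0 * h 0)        ≈⟨ *-congˡ (+-identityʳ _) ⟨
    f 0 * (g 0 * h 0 ⊹ 0#)   ∎)
  ⋆-assoc f g h (suc n) = begin
    (f 0 * g 0 ⊹ 0#) * h (suc n) ⊹ ((λ i → f 0 * g (suc i) ⊹ ((f ∘ suc) ⋆ g) i) ⋆ h) n
      ≈⟨ +-cong (trans (*-congʳ (+-identityʳ _)) (*-assoc _ _ _)) (⋆-distribʳ h (λ i → f 0 * g (suc i)) ((f ∘ suc) ⋆ g) n) ⟩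
    f 0 * (g 0 * h (suc n)) ⊹ (((λ i → f 0 * g (suc i)) ⋆ h) n ⊹ (((f ∘ suc) ⋆ g) ⋆ h) n)
      ≈⟨ +-congˡ (+-cong (⋆-scaleˡ (f 0) (g ∘ suc) h n) (⋆-assoc (f ∘ suc) g h n)) ⟩
    f 0 * (g 0 * h (suc n)) ⊹ (f 0 * ((g ∘ suc) ⋆ h) n ⊹ ((f ∘ suc) ⋆ (g ⋆ h)) n)
      ≈⟨ +-assoc _ _ _ ⟨
    f 0 * (g 0 * h (suc n)) ⊹ f 0 * ((g ∘ suc) ⋆ h) n ⊹ ((f ∘ suc) ⋆ (g ⋆ h)) n
      ≈⟨ +-congʳ (distribˡ _ _ _) ⟨
    f 0 * (g 0 * h (suc n) ⊹ ((g ∘ suc) ⋆ h) n) ⊹ ((f ∘ suc) ⋆ (g ⋆ h)) n ∎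

  ⋆-last : ∀ f g n → (f ⋆ g) (suc n) ≈ (f ⋆ (g ∘ suc)) n ⊹ f (suc n) * g 0
  ⋆-last f g zero    = trans (+-congˡ (+-identityʳ _)) (+-congʳ (sym (+-identityʳ _)))
  ⋆-last f g (suc n) = trans (+-congˡ (⋆-last (f ∘ suc) g n)) (sym (+-assoc _ _ _))

  ⋆-comm : ∀ f g → f ⋆ g ≐ g ⋆ f
  ⋆-comm f g zero    = +-congʳ (*-comm _ _)
  ⋆-comm f g (suc n) = begin
    f 0 * g (suc n) ⊹ ((f ∘ suc) ⋆ g) n   ≈⟨ +-cong (*-comm _ _) (⋆-comm (f ∘ suc) g n) ⟩
    g (suc n) * f 0 ⊹ (g ⋆ (f ∘ suc)) n   ≈⟨ +-comm _ _ ⟩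
    (g ⋆ (f ∘ suc)) n ⊹ g (suc n) * f 0   ≈⟨ ⋆-last g f n ⟨
    (g ⋆ f) (suc n)                       ∎

  ⋆-leftComm : ∀ f g h → f ⋆ (g ⋆ h) ≐ g ⋆ (f ⋆ h)
  ⋆-leftComm f g h n = begin
    (f ⋆ (g ⋆ h)) n   ≈⟨ ⋆-assoc f g h n ⟨
    ((f ⋆ g) ⋆ h) n   ≈⟨ ⋆-cong {f ⋆ g} {g ⋆ f} {h} (⋆-comm f g) (λ _ → refl) n ⟩
    ((g ⋆ f) ⋆ h) n   ≈⟨ ⋆-assoc g f h n ⟩
    (g ⋆ (f ⋆ h)) n   ∎

  ⋆-distribˡ : ∀ f g h n → (f ⋆ (λ i → g i ⊹ h i)) n ≈ (f ⋆ g) n ⊹ (f ⋆ h) n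
  ⋆-distribˡ f g h n = trans (⋆-comm f (λ i → g i ⊹ h i) n)
    (trans (⋆-distribʳ f g h n) (+-cong (⋆-comm g f n) (⋆-comm h f n)))

  ⋆-scaleʳ : ∀ a f g n → (f ⋆ (λ i → a * g i)) n ≈ a * (f ⋆ g) n
  ⋆-scaleʳ a f g n = trans (⋆-comm f (λ i → a * g i) n)
    (trans (⋆-scaleˡ a g f n) (*-congˡ (⋆-comm g f n)))

  ⋆-sumʳ : ∀ {k} f (G : Fin k → Series) n → (f ⋆ (λ i → sum (λ j → G j i))) n ≈ sum (λ j → (f ⋆ G j) n)
  ⋆-sumʳ {zero}  f G n = ⋆-zeroʳ f n
  ⋆-sumʳ {suc k} f G n = trans
    (⋆-distribˡ f (G zero) (λ i → sum (λ j → G (suc j) i)) n) (+-congˡ (⋆-sumʳ f (G ∘ suc) n))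

  -- The powers of a series without constant term have increasing order.
  ^-vanishes : ∀ f → f 0 ≈ 0# → ∀ k n → n < k → (f ⋆^ k) n ≈ 0#
  ^-vanishes f f₀≈0 (suc k) zero    _ = trans (+-identityʳ _) (trans (*-congʳ f₀≈0) (zeroˡ _))
  ^-vanishes f f₀≈0 (suc k) (suc n) (s≤s n<k) = begin
    f 0 * (f ⋆^ k) (suc n) ⊹ ((f ∘ suc) ⋆ f ⋆^ k) n
      ≈⟨ +-cong (trans (*-congʳ f₀≈0) (zeroˡ _))
                (⋆-cong-≤ {f ∘ suc} n (λ _ _ → refl) λ i i≤n → ^-vanishes f f₀≈0 k i (ℕₚ.≤-<-trans i≤n n<k)) ⟩
    0# ⊹ ((f ∘ suc) ⋆ const 0#) n   ≈⟨ +-identityˡ _ ⟩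
    ((f ∘ suc) ⋆ const 0#) n        ≈⟨ ⋆-zeroʳ (f ∘ suc) n ⟩
    0#                              ∎

  -- shift j f is the series zʲ f.
  shift : ℕ → Series → Series
  shift zero    f n       = f n
  shift (suc j) f zero    = 0#
  shift (suc j) f (suc n) = shift j f n

  shift-≤ : ∀ j f n → j ≤ n → shift j f n ≡ f (n ∸ j)
  shift-≤ zero    f n       _         = ≡.refl
  shift-≤ (suc j) f (suc n) (s≤s j≤n) = shift-≤ j f n j≤n

  shift-> : ∀ j f n → n < j → shift j f n ≡ 0#
  shift-> (suc j) f zero    _         = ≡.refl
  shift-> (suc j) f (suc n) (s≤s n<j) = shift-> j f n n<j

  -- monomial j a is the series a zʲ.
  monomial : ℕ → Carrier → Series
  monomial j a = shift j λ { zero → a ; (suc _) → 0# }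

  monomial-⋆ : ∀ j a f n → (monomial j a ⋆ f) n ≈ a * shift j f n
  monomial-⋆ zero a f zero = +-identityʳ _
  monomial-⋆ zero a f (suc n) =
    trans (+-congˡ (trans (⋆-comm _ f n) (⋆-zeroʳ f n))) (+-identityʳ _)
  monomial-⋆ (suc j) a f zero = trans (+-identityʳ _) (trans (zeroˡ _) (sym (zeroʳ a)))
  monomial-⋆ (suc j) a f (suc n) =
    trans (+-cong (zeroˡ _) (monomial-⋆ j a f n)) (+-identityˡ _)

-- Inverses of natural numbers in the base field

module FieldProperties (F : Field₀) where
  open Field₀ F hiding (_+_; _×_; zero)
  open Field₀ F using () renaming (_×_ to infixr 8 _×ₙ_)

  commutativeRing : CommutativeRing 0ℓ 0ℓ
  commutativeRing = record { isCommutativeRing = isCommutativeRing }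
  open CommutativeRing commutativeRing public using (semiring; ring; *-commutativeSemigroup; +-commutativeMonoid)
  open SemiringMult semiring using (×1-homo-*)
  open RingProperties ring using (-0#≈0#)
  open SetoidReasoning setoid

  1/[]-inverse : ∀ {x y} (x#y : x # y) → (x - y) * 1/[ x#y ] ≈ 1#
  1/[]-inverse x#y = proj₂ (proj₂ (#⇒invertible x#y))

  1/-inverse : ∀ n .{{_ : NonZero n}} → (n ×ₙ 1#) * 1/ n ≈ 1#
  1/-inverse n = begin
    (n ×ₙ 1#) * 1/ n          ≈⟨ *-congʳ (trans (+-congˡ -0#≈0#) (+-identityʳ _)) ⟨
    (n ×ₙ 1# - 0#) * 1/ n     ≈⟨ 1/[]-inverse (charZero n) ⟩
    1#                        ∎

  ×1-cancelˡ : ∀ n .{{_ : NonZero n}} {x y} → (n ×ₙ 1#) * x ≈ (n ×ₙ 1#) * y → x ≈ y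
  ×1-cancelˡ n {x} {y} e = trans (sym (step x)) (trans (*-congˡ e) (step y))
    where
    step : ∀ z → 1/ n * ((n ×ₙ 1#) * z) ≈ z
    step z = begin
      1/ n * ((n ×ₙ 1#) * z)   ≈⟨ *-assoc _ _ _ ⟨
      1/ n * (n ×ₙ 1#) * z     ≈⟨ *-congʳ (trans (*-comm _ _) (1/-inverse n)) ⟩
      1# * z                   ≈⟨ *-identityˡ z ⟩
      z                        ∎

  1/1≈1 : 1/ 1 ≈ 1#
  1/1≈1 = trans (sym (*-identityˡ _)) (trans (*-congʳ (sym (+-identityʳ 1#))) (1/-inverse 1))

  -- 1/k! as it occurs in the exponential series.
  1/! : ℕ → Carrier
  1/! k = 1/ (k !) {{k ℕₚ.!≢0}}

  1/!-suc : ∀ k → (suc k ×ₙ 1#) * 1/! (suc k) ≈ 1/! k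
  1/!-suc k = ×1-cancelˡ (k !) {{k ℕₚ.!≢0}} (begin
    ((k !) ×ₙ 1#) * ((suc k ×ₙ 1#) * 1/! (suc k))   ≈⟨ *-assoc _ _ _ ⟨
    ((k !) ×ₙ 1#) * (suc k ×ₙ 1#) * 1/! (suc k)     ≈⟨ *-congʳ (trans (*-comm _ _) (sym (×1-homo-* (suc k) (k !)))) ⟩
    ((suc k !) ×ₙ 1#) * 1/! (suc k)                 ≈⟨ 1/-inverse (suc k !) {{suc k ℕₚ.!≢0}} ⟩
    1#                                              ≈⟨ 1/-inverse (k !) {{k ℕₚ.!≢0}} ⟨
    ((k !) ×ₙ 1#) * 1/! k                           ∎)

-- Derivations and the exponential

-- A commutative algebra over F, given by its structure map ι.
module AlgebraOver
  (F : Field₀) (R : CommutativeRing 0ℓ 0ℓ)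
  (ι : Field₀.Carrier F → CommutativeRing.Carrier R)
  (ι-isHomomorphism : SemiringMorphisms.IsSemiringHomomorphism (Field₀.rawSemiring F) (rawSemiringOf R) ι)
  where
  open CommutativeRing R hiding (zero) renaming (_+_ to _⊹_)
  open Convolution R
  open FieldProperties F using (1/!; 1/!-suc)
  open Exponential F (rawSemiringOf R) (λ c x → ι c * x) public using (exp)
  open SemiringMorphisms.IsSemiringHomomorphism ι-isHomomorphism
    renaming (⟦⟧-cong to ι-cong; +-homo to ι-+; *-homo to ι-*; 0#-homo to ι-0; 1#-homo to ι-1)
  open SetoidReasoning setoid
  private module K = Field₀ F

  -- The partial sum of the exponential series up to the N-th power. Unlike exp, it
  -- has the same cut-off at every coefficient.
  expTo : ℕ → Series → Series
  expTo N f n = ∑[ k ∈ 0 ⋯ N ] (ι (1/! k) * (f ⋆^ k) n)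

  expTo-stable : ∀ f → f 0 ≈ 0# → ∀ N n → n ≤ N → expTo N f n ≈ exp f n
  expTo-stable f f₀≈0 N n n≤N = ∑-truncate N n (λ k → ι (1/! k) * (f ⋆^ k) n)
    (λ k N<k → vanish k (ℕₚ.≤-<-trans n≤N N<k)) vanish
    where
    vanish : ∀ k → n < k → ι (1/! k) * (f ⋆^ k) n ≈ 0#
    vanish k n<k = trans (*-congˡ (^-vanishes f f₀≈0 k n n<k)) (zeroʳ _)

  -- The structure of a derivation on power series over R that acts on the
  -- coefficient of zⁿ by the additive map δ n and kills the constants of F.
  record GradedDerivation : Set where
    field
      δ         : ℕ → Carrier → Carrier
      δ-cong    : ∀ n {x y} → x ≈ y → δ n x ≈ δ n y
      δ-+       : ∀ n x y → δ n (x ⊹ y) ≈ δ n x ⊹ δ n y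
      δ-leibniz : ∀ i j x y → δ (i + j) (x * y) ≈ δ i x * y ⊹ x * δ j y
      δ-ι       : ∀ c → δ 0 (ι c) ≈ 0#

    -- The derivation itself, on series.
    D : Series → Series
    D f n = δ n (f n)

    δ-scale : ∀ n c x → δ n (ι c * x) ≈ ι c * δ n x
    δ-scale n c x = begin
      δ n (ι c * x)                 ≈⟨ δ-leibniz 0 n (ι c) x ⟩
      δ 0 (ι c) * x ⊹ ι c * δ n x   ≈⟨ +-congʳ (trans (*-congʳ (δ-ι c)) (zeroˡ x)) ⟩
      0# ⊹ ι c * δ n x              ≈⟨ +-identityˡ _ ⟩
      ι c * δ n x                   ∎

    δ-0 : ∀ n → δ n 0# ≈ 0#
    δ-0 n = begin
      δ n 0#                ≈⟨ δ-cong n (zeroʳ _) ⟨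
      δ n (ι K.0# * 0#)     ≈⟨ δ-scale n K.0# 0# ⟩
      ι K.0# * δ n 0#       ≈⟨ *-congʳ ι-0 ⟩
      0# * δ n 0#           ≈⟨ zeroˡ _ ⟩
      0#                    ∎

    D-𝟙 : D 𝟙 ≐ const 0#
    D-𝟙 zero    = trans (δ-cong 0 (sym ι-1)) (δ-ι K.1#)
    D-𝟙 (suc n) = δ-0 (suc n)

    δ-sum : ∀ n {k} (x : Fin k → Carrier) → δ n (sum x) ≈ sum (λ i → δ n (x i))
    δ-sum n {zero}  x = δ-0 n
    δ-sum n {suc k} x = trans (δ-+ n (x zero) (sum (x ∘ suc))) (+-congˡ (δ-sum n (x ∘ suc)))

    D-⋆ : ∀ f g n → D (f ⋆ g) n ≈ (D f ⋆ g) n ⊹ (f ⋆ D g) n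
    D-⋆ f g n = begin
      δ n (∑[ i ∈ 0 ⋯ n ] (f i * g (n ∸ i)))
        ≈⟨ δ-sum n {suc n} (λ i → f (toℕ i) * g (n ∸ toℕ i)) ⟩
      ∑[ i ∈ 0 ⋯ n ] (δ n (f i * g (n ∸ i)))
        ≈⟨ ∑-cong n (λ i i≤n → ≡.subst (λ m → δ m (f i * g (n ∸ i)) ≈ D f i * g (n ∸ i) ⊹ f i * D g (n ∸ i))
             (ℕₚ.m+[n∸m]≡n i≤n) (δ-leibniz i (n ∸ i) (f i) (g (n ∸ i)))) ⟩
      ∑[ i ∈ 0 ⋯ n ] (D f i * g (n ∸ i) ⊹ f i * D g (n ∸ i))
        ≈⟨ ∑-distrib-+ {suc n} (λ i → D f (toℕ i) * g (n ∸ toℕ i)) (λ i → f (toℕ i) * D g (n ∸ toℕ i)) ⟩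
      (D f ⋆ g) n ⊹ (f ⋆ D g) n ∎

    -- The power rule, proved together with its multiple by f, in which no
    -- exponent k - 1 appears.
    D-^ : ∀ f k n → D (f ⋆^ suc k) n ≈ ι (suc k K.× K.1#) * (D f ⋆ (f ⋆^ k)) n
    ⋆-D-^ : ∀ f k n → (f ⋆ D (f ⋆^ k)) n ≈ ι (k K.× K.1#) * (D f ⋆ (f ⋆^ k)) n

    D-^ f k n = begin
      D (f ⋆ (f ⋆^ k)) n                            ≈⟨ D-⋆ f (f ⋆^ k) n ⟩
      X ⊹ (f ⋆ D (f ⋆^ k)) n                        ≈⟨ +-cong (sym (*-identityˡ X)) (⋆-D-^ f k n) ⟩
      1# * X ⊹ ι (k K.× K.1#) * X                   ≈⟨ distribʳ X _ _ ⟨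
      (1# ⊹ ι (k K.× K.1#)) * X                     ≈⟨ *-congʳ (trans (+-congʳ (sym ι-1)) (sym (ι-+ _ _))) ⟩
      ι (suc k K.× K.1#) * X                        ∎
      where X = (D f ⋆ (f ⋆^ k)) n

    ⋆-D-^ f zero n = begin
      (f ⋆ D 𝟙) n                   ≈⟨ ⋆-cong {f} {f} {D 𝟙} {const 0#} (λ _ → refl) D-𝟙 n ⟩
      (f ⋆ const 0#) n              ≈⟨ ⋆-zeroʳ f n ⟩
      0#                            ≈⟨ trans (*-congʳ ι-0) (zeroˡ _) ⟨
      ι K.0# * (D f ⋆ 𝟙) n          ∎
    ⋆-D-^ f (suc k) n = begin
      (f ⋆ D (f ⋆^ suc k)) n
        ≈⟨ ⋆-cong {f} {f} {D (f ⋆^ suc k)} {λ i → ι (suc k K.× K.1#) * (D f ⋆ (f ⋆^ k)) i} (λ _ → refl) (D-^ f k) n ⟩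
      (f ⋆ (λ i → ι (suc k K.× K.1#) * (D f ⋆ (f ⋆^ k)) i)) n
        ≈⟨ ⋆-scaleʳ _ f (D f ⋆ (f ⋆^ k)) n ⟩
      ι (suc k K.× K.1#) * (f ⋆ (D f ⋆ (f ⋆^ k))) n
        ≈⟨ *-congˡ (⋆-leftComm f (D f) (f ⋆^ k) n) ⟩
      ι (suc k K.× K.1#) * (D f ⋆ (f ⋆^ suc k)) n ∎

    -- Truncated one step apart, the two sides of the chain rule agree exactly.
    D-expTo : ∀ f N → D (expTo (suc N) f) ≐ D f ⋆ expTo N f
    D-expTo f N n = begin
      δ n (ι (1/! 0) * 𝟙 n ⊹ ∑[ k ∈ 0 ⋯ N ] (ι (1/! (suc k)) * (f ⋆^ suc k) n))
        ≈⟨ δ-+ n _ _ ⟩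
      δ n (ι (1/! 0) * 𝟙 n) ⊹ δ n (∑[ k ∈ 0 ⋯ N ] (ι (1/! (suc k)) * (f ⋆^ suc k) n))
        ≈⟨ +-cong (trans (δ-scale n _ _) (trans (*-congˡ (D-𝟙 n)) (zeroʳ _)))
                  (δ-sum n {suc N} (λ k → ι (1/! (suc (toℕ k))) * (f ⋆^ suc (toℕ k)) n)) ⟩
      0# ⊹ ∑[ k ∈ 0 ⋯ N ] (δ n (ι (1/! (suc k)) * (f ⋆^ suc k) n))
        ≈⟨ trans (+-identityˡ _) (∑-cong N λ k _ → term k) ⟩
      ∑[ k ∈ 0 ⋯ N ] ((D f ⋆ (λ i → ι (1/! k) * (f ⋆^ k) i)) n)
        ≈⟨ ⋆-sumʳ {suc N} (D f) (λ k i → ι (1/! (toℕ k)) * (f ⋆^ toℕ k) i) n ⟨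
      (D f ⋆ expTo N f) n ∎
      where
      term : ∀ k → δ n (ι (1/! (suc k)) * (f ⋆^ suc k) n) ≈ (D f ⋆ (λ i → ι (1/! k) * (f ⋆^ k) i)) n
      term k = begin
        δ n (ι (1/! (suc k)) * (f ⋆^ suc k) n)          ≈⟨ trans (δ-scale n _ _) (*-congˡ (D-^ f k n)) ⟩
        ι (1/! (suc k)) * (ι (suc k K.× K.1#) * X)      ≈⟨ *-assoc _ _ _ ⟨
        ι (1/! (suc k)) * ι (suc k K.× K.1#) * X        ≈⟨ *-congʳ (trans (*-comm _ _) (sym (ι-* _ _))) ⟩
        ι ((suc k K.× K.1#) K.* 1/! (suc k)) * X        ≈⟨ *-congʳ (ι-cong (1/!-suc k)) ⟩
        ι (1/! k) * X                                   ≈⟨ ⋆-scaleʳ _ (D f) (f ⋆^ k) n ⟨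
        (D f ⋆ (λ i → ι (1/! k) * (f ⋆^ k) i)) n        ∎
        where X = (D f ⋆ (f ⋆^ k)) n

    -- The chain rule for the exponential.
    D-exp : ∀ f → f 0 ≈ 0# → D (exp f) ≐ D f ⋆ exp f
    D-exp f f₀≈0 n = begin
      δ n (exp f n)                 ≈⟨ δ-cong n (expTo-stable f f₀≈0 (suc n) n (ℕₚ.n≤1+n n)) ⟨
      δ n (expTo (suc n) f n)       ≈⟨ D-expTo f n n ⟩
      (D f ⋆ expTo n f) n           ≈⟨ ⋆-cong-≤ {D f} {D f} {expTo n f} {exp f} n (λ _ _ → refl) (λ i → expTo-stable f f₀≈0 n i) ⟩
      (D f ⋆ exp f) n               ∎

-- Series with odd exponents only

odd-suc : ∀ k → odd (suc k) ≡ suc (suc (odd k))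
odd-suc k = ≡.cong suc (ℕₚ.*-suc 2 k)

-- A relation between two sequences of coefficients, which may depend on the
-- exponent, lifts to the odd series that they define, if it holds for 0 and 0.
oddSeries-rel : ∀ (R S : RawSemiring 0ℓ 0ℓ) (P : ℕ → RawSemiring.Carrier R → RawSemiring.Carrier S → Set) {c d} →
  (∀ n → P n (RawSemiring.0# R) (RawSemiring.0# S)) → (∀ k → P (odd k) (c k) (d k)) →
  ∀ n → P n (PowerSeries.oddSeries R c n) (PowerSeries.oddSeries S d n)
oddSeries-rel R S P P₀ P₁ zero          = P₀ 0
oddSeries-rel R S P P₀ P₁ (suc zero)    = P₁ 0
oddSeries-rel R S P {c} {d} P₀ P₁ (suc (suc n)) =
  oddSeries-rel R S (λ m → P (suc (suc m))) (λ m → P₀ (suc (suc m)))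
    (λ k → ≡.subst (λ m → P m (c (suc k)) (d (suc k))) (odd-suc k) (P₁ (suc k))) n

module OddSeries (R : CommutativeRing 0ℓ 0ℓ) where
  open CommutativeRing R hiding (zero)
  open Convolution R

  oddSeries-zero : ∀ c → (∀ k → c k ≈ 0#) → oddSeries c ≐ const 0#
  oddSeries-zero c c≈0 = oddSeries-rel (rawSemiringOf R) (rawSemiringOf R) (λ _ x _ → x ≈ 0#) {d = c} (λ _ → refl) c≈0

  oddSeries-single : ∀ k c {a} → c k ≈ a → (∀ j → j ≢ k → c j ≈ 0#) → oddSeries c ≐ monomial (odd k) a
  oddSeries-single zero    c e z zero          = refl
  oddSeries-single zero    c e z (suc zero)    = e
  oddSeries-single zero    c e z (suc (suc n)) = oddSeries-zero (c ∘ suc) (λ j → z (suc j) λ ()) n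
  oddSeries-single (suc k) c {a} e z n = ≡.subst (λ m → oddSeries c n ≈ monomial m a n) (≡.sym (odd-suc k)) (step n)
    where
    step : oddSeries c ≐ monomial (suc (suc (odd k))) a
    step zero          = refl
    step (suc zero)    = z 0 λ ()
    step (suc (suc n)) = oddSeries-single k (c ∘ suc) e (λ j j≢k → z (suc j) (j≢k ∘ ℕₚ.suc-injective)) n

-- Exponentials of series of operators

-- Here v is a sequence in Γ, and A is an F-algebra that acts on Γ through φ. Two
-- instances matter: A = Γ with v constant, and A = F with v j = zʲ g for a fixed
-- series g, read off at one exponent.
module OperatorExponential
  (F : Field₀) (A : CommutativeRing 0ℓ 0ℓ)
  (ι : Field₀.Carrier F → CommutativeRing.Carrier A)
  (φ : CommutativeRing.Carrier A → Fock.Γ F)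
  (φ-isHomomorphism : SemiringMorphisms.IsSemiringHomomorphism (rawSemiringOf A) (Fock.Γ-rawSemiring F) φ)
  (φ-ι : ∀ c → Fock._≋_ F (φ (ι c)) (Fock.con c))
  (v : ℕ → Fock.Γ F)
  where
  open Fock F
  open CommutativeRing A using (_≈_; _*_; *-assoc; zeroˡ; 0#; 1#; *-identityˡ; *-identityʳ) renaming (Carrier to C; sym to ≈-sym; trans to ≈-trans)
  open SemiringMorphisms.IsSemiringHomomorphism φ-isHomomorphism
    renaming (⟦⟧-cong to φ-cong; +-homo to φ-+; *-homo to φ-*; 0#-homo to φ-0; 1#-homo to φ-1)
  open FieldProperties F using (1/!)
  module ConvA = Convolution A
  module ConvΓ = Convolution Γ-commutativeRing
  open ConvΓ using (sum)
  open RawSemiringOps SerOp.seriesSemiring using () renaming (_^_ to _^ᵒ_)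
  open RawSemiringOps Op-rawSemiring using () renaming (sum to sumOp)
  open SetoidReasoning ≋-setoid
  module ExpA = Exponential F (rawSemiringOf A) (λ c x → ι c * x)

  -- T multiplies A-multiples of the v j by a and shifts their index by i. The
  -- argument is taken up to ≋, so that no congruence is asked of T separately.
  ActsAt : ℕ → Op → C → Set
  ActsAt i T a = ∀ b j {f} → f ≋ φ b ⊗ v j → T f ≋ φ (a * b) ⊗ v (i + j)

  -- The operator series T acts along v as the scalar series a.
  Acts : (ℕ → Op) → (ℕ → C) → Set
  Acts T a = ∀ i → ActsAt i (T i) (a i)

  acts-0 : ∀ i → ActsAt i (const 𝟎) 0#
  acts-0 i b j _ = ≋-sym (begin
    φ (0# * b) ⊗ v (i + j)   ≈⟨ ⊗-cong (≋-trans (φ-cong (zeroˡ b)) φ-0) ≋-refl ⟩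
    𝟎 ⊗ v (i + j)            ≈⟨ ⊗-zeroˡ _ ⟩
    𝟎                        ∎)

  sumOp-apply : ∀ {n} (T : Fin n → Op) f → sumOp T f ≡ sum (λ i → T i f)
  sumOp-apply {zero}  T f = ≡.refl
  sumOp-apply {suc n} T f = ≡.cong (T zero f ⊕_) (sumOp-apply (T ∘ suc) f)

  sum-⊗ : ∀ {n} (x : Fin n → C) b w → sum (λ i → φ (x i * b) ⊗ w) ≋ φ (ConvA.sum x * b) ⊗ w
  sum-⊗ {zero}  x b w = ≋-sym (≋-trans (⊗-cong (≋-trans (φ-cong (zeroˡ b)) φ-0) ≋-refl) (⊗-zeroˡ w))
  sum-⊗ {suc n} x b w = begin
    φ (x zero * b) ⊗ w ⊕ sum (λ i → φ (x (suc i) * b) ⊗ w)            ≈⟨ ⊕-cong ≋-refl (sum-⊗ (x ∘ suc) b w) ⟩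
    φ (x zero * b) ⊗ w ⊕ φ (ConvA.sum (x ∘ suc) * b) ⊗ w              ≈⟨ ⊗-distribʳ w _ _ ⟨
    (φ (x zero * b) ⊕ φ (ConvA.sum (x ∘ suc) * b)) ⊗ w                ≈⟨ ⊗-cong (φ-+ _ _) ≋-refl ⟨
    φ (x zero * b A.+ ConvA.sum (x ∘ suc) * b) ⊗ w                    ≈⟨ ⊗-cong (φ-cong (A.distribʳ b _ _)) ≋-refl ⟨
    φ ((x zero A.+ ConvA.sum (x ∘ suc)) * b) ⊗ w                      ∎
    where module A = CommutativeRing A

  acts-sum : ∀ {n i} (T : Fin n → Op) (a : Fin n → C) → (∀ k → ActsAt i (T k) (a k)) → ActsAt i (sumOp T) (ConvA.sum a)
  acts-sum {i = i} T a acts b j {f} e = begin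
    sumOp T f                               ≡⟨ sumOp-apply T f ⟩
    sum (λ k → T k f)                       ≈⟨ ConvΓ.sum-cong-≋ (λ k → acts k b j e) ⟩
    sum (λ k → φ (a k * b) ⊗ v (i + j))     ≈⟨ sum-⊗ a b (v (i + j)) ⟩
    φ (ConvA.sum a * b) ⊗ v (i + j)         ∎

  acts-∘ : ∀ {i j n S T a b} → i + j ≡ n → ActsAt i S a → ActsAt j T b → ActsAt n (S ∘ T) (a * b)
  acts-∘ {i} {j} {n} {S} {T} {a} {b} ≡.refl actsS actsT c l {f} e = begin
    S (T f)                              ≈⟨ actsS (b * c) (j + l) (actsT c l e) ⟩
    φ (a * (b * c)) ⊗ v (i + (j + l))    ≈⟨ ⊗-cong (φ-cong (*-assoc a b c)) ≋-refl ⟨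
    φ (a * b * c) ⊗ v (i + (j + l))      ≡⟨ ≡.cong (λ m → φ (a * b * c) ⊗ v m) (ℕₚ.+-assoc i j l) ⟨
    φ (a * b * c) ⊗ v (i + j + l)        ∎

  acts-• : ∀ {i T a} c → ActsAt i T a → ActsAt i (c •ᵒ T) (ι c * a)
  acts-• {i} {T} {a} c acts b j {f} e = begin
    con c ⊗ T f                           ≈⟨ ⊗-cong (≋-sym (φ-ι c)) (acts b j e) ⟩
    φ (ι c) ⊗ (φ (a * b) ⊗ v (i + j))     ≈⟨ ⊗-assoc _ _ _ ⟨
    (φ (ι c) ⊗ φ (a * b)) ⊗ v (i + j)     ≈⟨ ⊗-cong (φ-* _ _) ≋-refl ⟨
    φ (ι c * (a * b)) ⊗ v (i + j)         ≈⟨ ⊗-cong (φ-cong (*-assoc _ _ _)) ≋-refl ⟨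
    φ (ι c * a * b) ⊗ v (i + j)           ∎

  acts-^ : ∀ {T a} → Acts T a → ∀ k → Acts (T ^ᵒ k) (a ConvA.⋆^ k)
  acts-^ acts zero zero b j e = ≋-trans e (⊗-cong (φ-cong (≈-sym (*-identityˡ b))) ≋-refl)
  acts-^ acts zero (suc i) = acts-0 (suc i)
  acts-^ {T} {a} acts (suc k) n = acts-sum {suc n}
    (λ i → T (toℕ i) ∘ (T ^ᵒ k) (n ∸ toℕ i)) (λ i → a (toℕ i) * (a ConvA.⋆^ k) (n ∸ toℕ i))
    (λ i → acts-∘ (ℕₚ.m+[n∸m]≡n (toℕ≤pred[n] i)) (acts (toℕ i)) (acts-^ acts k (n ∸ toℕ i)))

  -- If the coefficients of T act by those of a, then those of exp T act by those of
  -- exp a. This reduces exponentials of operators to exponentials of scalars.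
  acts-exp : ∀ {T a} → Acts T a → Acts (ExpOp.exp T) (ExpA.exp a)
  acts-exp {T} {a} acts n = acts-sum {suc n}
    (λ k → 1/! (toℕ k) •ᵒ (T ^ᵒ toℕ k) n) (λ k → ι (1/! (toℕ k)) * (a ConvA.⋆^ toℕ k) n)
    (λ k → acts-• (1/! (toℕ k)) (acts-^ acts (toℕ k) n))

  acts-oddSeries : ∀ {c d} → (∀ k → ActsAt (odd k) (c k) (d k)) → Acts (SerOp.oddSeries c) (ConvA.oddSeries d)
  acts-oddSeries = oddSeries-rel Op-rawSemiring (rawSemiringOf A) ActsAt acts-0

  acts⇒≋ : ∀ {T a} → Acts T a → ∀ n {f} → f ≋ v 0 → T n f ≋ φ (a n) ⊗ v n
  acts⇒≋ {T} {a} acts n {f} e = begin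
    T n f                       ≈⟨ acts n 1# 0 (≋-trans e (≋-sym (≋-trans (⊗-cong φ-1 ≋-refl) (⊗-identityˡ _)))) ⟩
    φ (a n * 1#) ⊗ v (n + 0)    ≈⟨ ⊗-cong (φ-cong (*-identityʳ _)) ≋-refl ⟩
    φ (a n) ⊗ v (n + 0)         ≡⟨ ≡.cong (λ m → φ (a n) ⊗ v m) (ℕₚ.+-identityʳ n) ⟩
    φ (a n) ⊗ v n               ∎

-- Vertex operators on the Fock space

module FockProperties (F : Field₀) where
  open Fock F
  private module K where
    open Field₀ F public
    open FieldProperties F public
  open K using (0#; 1#; _*_; _≈_; -_; 1/) renaming (_+_ to _⊹_; _×_ to infixr 8 _×ₙ_)
  module ΓR = CommutativeRing Γ-commutativeRing
  module ConvΓ = Convolution Γ-commutativeRing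
  open ConvΓ using (shift; monomial)

  con-isHomomorphism : SemiringMorphisms.IsSemiringHomomorphism K.rawSemiring Γ-rawSemiring con
  con-isHomomorphism = record
    { isNearSemiringHomomorphism = record
      { +-isMonoidHomomorphism = record
        { isMagmaHomomorphism = record { isRelHomomorphism = record { cong = con-cong } ; homo = con-+ }
        ; ε-homo = ≋-refl
        }
      ; *-homo = con-*
      }
    ; 1#-homo = ≋-refl
    }

  -- Γ and F itself as algebras over F.
  module AlgΓ = AlgebraOver F Γ-commutativeRing con con-isHomomorphism
  module AlgK = AlgebraOver F K.commutativeRing id (Identity.isSemiringHomomorphism K.rawSemiring K.refl)

  module _ where
    open SetoidReasoning ≋-setoid

    -- The creation part of the vertex operator is multiplication by its value on 𝟏.
    raising≋q⊗ : ∀ t i g → raising t i g ≋ q t i ⊗ g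
    raising≋q⊗ t i g = acts⇒≋ (acts-exp (acts-oddSeries acts-creation)) i ≋-refl
      where
      open OperatorExponential F Γ-commutativeRing con id
        (Identity.isSemiringHomomorphism Γ-rawSemiring ≋-refl) (λ _ → ≋-refl) (const g)
      acts-creation : ∀ k → let c = 2/ (odd k) * 1- t ^ odd k in ActsAt (odd k) (c •ᵒ creation k) (c • p k)
      acts-creation k b j {g′} e = begin
        con c ⊗ (p k ⊗ g′)             ≈⟨ ⊗-cong ≋-refl (⊗-cong ≋-refl e) ⟩
        con c ⊗ (p k ⊗ (b ⊗ g))        ≈⟨ ⊗-assoc _ _ _ ⟨
        (con c ⊗ p k) ⊗ (b ⊗ g)        ≈⟨ ⊗-assoc _ _ _ ⟨
        con c ⊗ p k ⊗ b ⊗ g            ∎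
        where c = 2/ (odd k) * 1- t ^ odd k

    -- ∂/∂pₙ applied to each coefficient of a series over Γ.
    ∂-derivation : ℕ → AlgΓ.GradedDerivation
    ∂-derivation k = record
      { δ         = λ _ → ∂ k
      ; δ-cong    = λ _ → ∂-cong k
      ; δ-+       = λ _ _ _ → ≋-refl
      ; δ-leibniz = λ _ _ _ _ → ≋-refl
      ; δ-ι       = λ _ → ≋-refl
      }

    ∂-p-same : ∀ k → ∂ k (p k) ≋ 𝟏
    ∂-p-same k with k ℕₚ.≟ k
    ... | yes _  = ≋-refl
    ... | no k≢k = contradiction ≡.refl k≢k

    ∂-p-other : ∀ {k j} → j ≢ k → ∂ k (p j) ≋ 𝟎
    ∂-p-other {k} {j} j≢k with k ℕₚ.≟ j
    ... | yes k≡j = contradiction (≡.sym k≡j) j≢k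
    ... | no _    = ≋-refl

    ∂-• : ∀ k c g → ∂ k (c • g) ≋ c • ∂ k g
    ∂-• k = AlgΓ.GradedDerivation.δ-scale (∂-derivation k) 0

    -- The generating function of the q t n is an eigenvector of every ∂/∂pₙ.
    ∂-q : ∀ t k n → ∂ k (q t n) ≋ (2/ (odd k) * 1- t ^ odd k) • shift (odd k) (q t) n
    ∂-q t k n = begin
      ∂ k (q t n)
        ≈⟨ AlgΓ.GradedDerivation.D-exp (∂-derivation k) (SerΓ.oddSeries c) ≋-refl n ⟩
      ((λ i → ∂ k (SerΓ.oddSeries c i)) ⋆ q t) n
        ≈⟨ ConvΓ.⋆-cong {g = q t} ∂c (λ _ → ≋-refl) n ⟩
      (monomial (odd k) (con (γ k)) ⋆ q t) n
        ≈⟨ ConvΓ.monomial-⋆ (odd k) (con (γ k)) (q t) n ⟩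
      γ k • shift (odd k) (q t) n ∎
      where
      open RawSemiring SerΓ.seriesSemiring using () renaming (_*_ to _⋆_)
      γ : ℕ → K.Carrier
      γ j = 2/ (odd j) * 1- t ^ odd j
      c : ℕ → Γ
      c j = γ j • p j
      ∂c : ∀ i → ∂ k (SerΓ.oddSeries c i) ≋ monomial (odd k) (con (γ k)) i
      ∂c i = ≋-trans
        (oddSeries-rel Γ-rawSemiring Γ-rawSemiring (λ _ x y → ∂ k x ≋ y) {d = ∂ k ∘ c} (λ _ → ≋-refl) (λ _ → ≋-refl) i)
        (OddSeries.oddSeries-single Γ-commutativeRing k (∂ k ∘ c)
          (≋-trans (∂-• k _ _) (≋-trans (⊗-cong ≋-refl (∂-p-same k)) (ΓR.*-identityʳ _)))
          (λ j j≢k → ≋-trans (∂-• k _ _) (≋-trans (⊗-cong ≋-refl (∂-p-other j≢k)) (ΓR.zeroʳ _))) i)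

    ∂-shift-q : ∀ t k j n → ∂ k (shift j (q t) n) ≋ (2/ (odd k) * 1- t ^ odd k) • shift (odd k + j) (q t) n
    ∂-shift-q t k j n = ≡.subst (λ m → ∂ k (shift j (q t) n) ≋ γ • shift m (q t) n) (ℕₚ.+-comm j (odd k)) (go j n)
      where
      γ = 2/ (odd k) * 1- t ^ odd k
      go : ∀ j n → ∂ k (shift j (q t) n) ≋ γ • shift (j + odd k) (q t) n
      go zero    n       = ∂-q t k n
      go (suc j) zero    = ≋-sym (ΓR.zeroʳ (con γ))
      go (suc j) (suc n) = go j n

  module _ where
    open SetoidReasoning K.setoid
    open CommutativeSemigroupProperties K.*-commutativeSemigroup using (interchange; x∙yz≈y∙xz)
    open RingProperties K.ring using (-‿distribˡ-*)

    -- The factor n/2 of the annihilation operator cancels one of the two factors 2/n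
    -- from the exponents.
    halves : ∀ n .{{_ : NonZero n}} → fromℕ n * 1/ 2 * 2/ n ≈ 1#
    halves n = begin
      fromℕ n * 1/ 2 * (fromℕ 2 * 1/ n)    ≈⟨ K.*-congˡ (K.*-comm _ _) ⟩
      fromℕ n * 1/ 2 * (1/ n * fromℕ 2)    ≈⟨ interchange _ _ _ _ ⟩
      fromℕ n * 1/ n * (1/ 2 * fromℕ 2)    ≈⟨ K.*-cong (K.1/-inverse n) (K.trans (K.*-comm _ _) (K.1/-inverse 2)) ⟩
      1# * 1#                              ≈⟨ K.*-identityˡ 1# ⟩
      1#                                   ∎

    lowering-coefficient : ∀ n .{{_ : NonZero n}} i u b →
      - (2/ n * i) * (fromℕ n * 1/ 2 * (b * (2/ n * u))) ≈ - (2/ n * (u * i)) * b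
    lowering-coefficient n i u b = begin
      - (2/ n * i) * (fromℕ n * 1/ 2 * (b * (2/ n * u)))     ≈⟨ K.*-congˡ (x∙yz≈y∙xz _ _ _) ⟩
      - (2/ n * i) * (b * (fromℕ n * 1/ 2 * (2/ n * u)))     ≈⟨ K.*-congˡ (K.*-congˡ (K.*-assoc _ _ _)) ⟨
      - (2/ n * i) * (b * (fromℕ n * 1/ 2 * 2/ n * u))       ≈⟨ K.*-congˡ (K.*-congˡ (K.trans (K.*-congʳ (halves n)) (K.*-identityˡ u))) ⟩
      - (2/ n * i) * (b * u)                                 ≈⟨ K.*-congˡ (K.*-comm b u) ⟩
      - (2/ n * i) * (u * b)                                 ≈⟨ K.*-assoc _ _ _ ⟨
      - (2/ n * i) * u * b                                   ≈⟨ K.*-congʳ (-‿distribˡ-* _ _) ⟨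
      - (2/ n * i * u) * b                                   ≈⟨ K.*-congʳ (K.-‿cong (K.*-assoc _ _ _)) ⟩
      - (2/ n * (i * u)) * b                                 ≈⟨ K.*-congʳ (K.-‿cong (K.*-congˡ (K.*-comm i u))) ⟩
      - (2/ n * (u * i)) * b                                 ∎

  module _ where
    open SetoidReasoning ≋-setoid

    -- The annihilation part of the vertex operator multiplies the generating
    -- function of the q s m by that of the f t s j.
    lowering-q : ∀ t s j m {g} → g ≋ q s m → lowering t j g ≋ f t s j • shift j (q s) m
    lowering-q t s j m = acts⇒≋ (acts-exp (acts-oddSeries acts-annihilation)) j
      where
      open OperatorExponential F K.commutativeRing id con con-isHomomorphism (λ _ → ≋-refl) (λ j → shift j (q s) m)
      acts-annihilation : ∀ k → ActsAt (odd k)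
        ((- (2/ (odd k) * 1/[1- t ^ odd k ])) •ᵒ annihilation k)
        (- (2/ (odd k) * (1- s ^ odd k * 1/[1- t ^ odd k ])))
      acts-annihilation k b j {g} e = begin
        con c ⊗ (con h ⊗ ∂ k g)
          ≈⟨ ⊗-cong ≋-refl (⊗-cong ≋-refl (≋-trans (∂-cong k e) (∂-• k b _))) ⟩
        con c ⊗ (con h ⊗ (con b ⊗ ∂ k (shift j (q s) m)))
          ≈⟨ ⊗-cong ≋-refl (⊗-cong ≋-refl (⊗-cong ≋-refl (∂-shift-q s k j m))) ⟩
        con c ⊗ (con h ⊗ (con b ⊗ (con γ ⊗ w)))
          ≈⟨ ⊗-cong ≋-refl (⊗-cong ≋-refl (con-*-⊗ b γ w)) ⟨
        con c ⊗ (con h ⊗ (con (b * γ) ⊗ w))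
          ≈⟨ ⊗-cong ≋-refl (con-*-⊗ h (b * γ) w) ⟨
        con c ⊗ (con (h * (b * γ)) ⊗ w)
          ≈⟨ con-*-⊗ c (h * (b * γ)) w ⟨
        con (c * (h * (b * γ))) ⊗ w
          ≈⟨ ⊗-cong (con-cong (lowering-coefficient (odd k) _ _ b)) ≋-refl ⟩
        con (- (2/ (odd k) * (1- s ^ odd k * 1/[1- t ^ odd k ])) * b) ⊗ w ∎
        where
        c = - (2/ (odd k) * 1/[1- t ^ odd k ])
        h = fromℕ (odd k) * 1/ 2
        γ = 2/ (odd k) * 1- s ^ odd k
        w = shift (odd k + j) (q s) m
        con-*-⊗ : ∀ a b g → con (a * b) ⊗ g ≋ con a ⊗ (con b ⊗ g)
        con-*-⊗ a b g = ≋-trans (⊗-cong (con-* a b) ≋-refl) (⊗-assoc _ _ _)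

    -- The summation bound depends on the expression g, not only on its class.
    𝒴-negative : ∀ t r g → 𝒴 t (ℤ.- (+ r)) g ≋ ∑[ j ∈ 0 ⋯ degree g ] (q t (r + j) ⊗ lowering t j g)
    𝒴-negative t r g = ConvΓ.∑-cong (degree g)
      {λ j → raisingℤ t (+ j ℤ.- (ℤ.- (+ r))) (lowering t j g)} {λ j → q t (r + j) ⊗ lowering t j g}
      λ j _ → begin
        raisingℤ t (+ j ℤ.- (ℤ.- (+ r))) (lowering t j g)
          ≡⟨ ≡.cong (λ i → raisingℤ t (+ j ℤ.+ i) (lowering t j g)) (ℤₚ.neg-involutive (+ r)) ⟩
        raising t (j + r) (lowering t j g)
          ≡⟨ ≡.cong (λ i → raising t i (lowering t j g)) (ℕₚ.+-comm j r) ⟩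
        raising t (r + j) (lowering t j g)
          ≈⟨ raising≋q⊗ t (r + j) _ ⟩
        q t (r + j) ⊗ lowering t j g ∎

    𝒴-𝟏 : ∀ s m → 𝒴 s (ℤ.- (+ m)) 𝟏 ≋ q s m
    𝒴-𝟏 s m = begin
      𝒴 s (ℤ.- (+ m)) 𝟏                      ≈⟨ 𝒴-negative s m 𝟏 ⟩
      q s (m + 0) ⊗ lowering s 0 𝟏 ⊕ 𝟎       ≈⟨ ΓR.+-identityʳ _ ⟩
      q s (m + 0) ⊗ (con (1/ 1) ⊗ 𝟏 ⊕ 𝟎)     ≈⟨ ⊗-cong ≋-refl (≋-trans (ΓR.+-identityʳ _) (≋-trans (ΓR.*-identityʳ _) (con-cong K.1/1≈1))) ⟩
      q s (m + 0) ⊗ 𝟏                        ≈⟨ ΓR.*-identityʳ _ ⟩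
      q s (m + 0)                            ≡⟨ ≡.cong (q s) (ℕₚ.+-identityʳ m) ⟩
      q s m                                  ∎

    -- The two-parameter expansion, for arbitrary parameters over any field.
    𝒬-expansion : ∀ t s r m → 𝒬 t s r m ≋ ∑[ k ∈ 0 ⋯ m ] (f t s k • (q t (r + k) ⊗ q s (m ∸ k)))
    𝒬-expansion t s r m = begin
      𝒴 t (ℤ.- (+ r)) g                                      ≈⟨ 𝒴-negative t r g ⟩
      ∑[ j ∈ 0 ⋯ degree g ] (x j)                            ≈⟨ ConvΓ.∑-truncate (degree g) m x above-degree above-m ⟩
      ∑[ j ∈ 0 ⋯ m ] (x j)                                   ≈⟨ ConvΓ.∑-cong m {x} {λ j → f t s j • (q t (r + j) ⊗ q s (m ∸ j))} term ⟩
      ∑[ j ∈ 0 ⋯ m ] (f t s j • (q t (r + j) ⊗ q s (m ∸ j))) ∎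
      where
      g = 𝒴 s (ℤ.- (+ m)) 𝟏
      x : ℕ → Γ
      x j = q t (r + j) ⊗ lowering t j g
      lowering-g : ∀ j → lowering t j g ≋ f t s j • shift j (q s) m
      lowering-g j = lowering-q t s j m (𝒴-𝟏 s m)
      above-degree : ∀ j → degree g < j → x j ≋ 𝟎
      above-degree j deg<j = ≋-trans (⊗-cong ≋-refl (lowering-vanishes t j g deg<j)) (ΓR.zeroʳ _)
      above-m : ∀ j → m < j → x j ≋ 𝟎
      above-m j m<j = begin
        q t (r + j) ⊗ lowering t j g                  ≈⟨ ⊗-cong ≋-refl (lowering-g j) ⟩
        q t (r + j) ⊗ (f t s j • shift j (q s) m)     ≡⟨ ≡.cong (λ y → q t (r + j) ⊗ (f t s j • y)) (ConvΓ.shift-> j (q s) m m<j) ⟩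
        q t (r + j) ⊗ (f t s j • 𝟎)                   ≈⟨ ⊗-cong ≋-refl (ΓR.zeroʳ _) ⟩
        q t (r + j) ⊗ 𝟎                               ≈⟨ ΓR.zeroʳ _ ⟩
        𝟎                                             ∎
      term : ∀ j → j ≤ m → x j ≋ f t s j • (q t (r + j) ⊗ q s (m ∸ j))
      term j j≤m = begin
        q t (r + j) ⊗ lowering t j g                  ≈⟨ ⊗-cong ≋-refl (lowering-g j) ⟩
        q t (r + j) ⊗ (f t s j • shift j (q s) m)     ≡⟨ ≡.cong (λ y → q t (r + j) ⊗ (f t s j • y)) (ConvΓ.shift-≤ j (q s) m j≤m) ⟩
        q t (r + j) ⊗ (f t s j • q s (m ∸ j))         ≈⟨ x∙yz≈y∙xz _ _ _ ⟩
        f t s j • (q t (r + j) ⊗ q s (m ∸ j))         ∎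
        where open CommutativeSemigroupProperties ΓR.*-commutativeSemigroup using (x∙yz≈y∙xz)

  module _ where
    open CommutativeMonoidMult K.+-commutativeMonoid using (×-distrib-+)
    open SemiringMult K.semiring using (×-congʳ; ×-homo-+; ×-assoc-*; ×-comm-*)
    open RingProperties K.ring using (-‿distribˡ-*; -‿distribʳ-*; -1*x≈-x; -‿involutive)
    open CommutativeSemigroupProperties K.*-commutativeSemigroup using (x∙yz≈y∙xz)
    open SetoidReasoning K.setoid
    open RawSemiring SerK.seriesSemiring using () renaming (_*_ to _⋆_)

    -- u d/du multiplies the coefficient of uⁿ by n.
    euler : AlgK.GradedDerivation
    euler = record
      { δ         = _×ₙ_
      ; δ-cong    = ×-congʳ
      ; δ-+       = λ n x y → ×-distrib-+ x y n
      ; δ-leibniz = λ i j x y → K.trans (×-homo-+ (x * y) i j) (K.+-cong (K.sym (×-assoc-* i x y)) (K.sym (×-comm-* j x y)))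
      ; δ-ι       = λ _ → K.refl
      }

    two : K.Carrier
    two = fromℕ 2

    -- The series -2(u + u³ + u⁵ + ⋯), which is u d/du of the exponent that
    -- defines f t t.
    logDerivative : ℕ → K.Carrier
    logDerivative = SerK.oddSeries (const (- two))

    -- The differential equation u f′ = -2(u + u³ + u⁵ + ⋯) f.
    f-euler : ∀ t n → n ×ₙ f t t n ≈ (logDerivative ⋆ f t t) n
    f-euler t n = K.trans (AlgK.GradedDerivation.D-exp euler (SerK.oddSeries c) K.refl n)
      (Convolution.⋆-cong K.commutativeRing {g = f t t} Dc (λ _ → K.refl) n)
      where
      c : ℕ → K.Carrier
      c k = - (2/ (odd k) * (1- t ^ odd k * 1/[1- t ^ odd k ]))
      coefficient : ∀ k → odd k ×ₙ c k ≈ - two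
      coefficient k = begin
        odd k ×ₙ c k
          ≈⟨ ×-congʳ (odd k) (K.-‿cong (K.trans (K.*-congˡ (K.1/[]-inverse (Parameter.1#val t (odd k)))) (K.*-identityʳ _))) ⟩
        odd k ×ₙ (- 2/ (odd k))
          ≈⟨ ×-congʳ (odd k) (K.*-identityˡ _) ⟨
        odd k ×ₙ (1# * (- 2/ (odd k)))
          ≈⟨ ×-assoc-* (odd k) 1# _ ⟨
        fromℕ (odd k) * (- 2/ (odd k))
          ≈⟨ -‿distribʳ-* _ _ ⟨
        - (fromℕ (odd k) * 2/ (odd k))
          ≈⟨ K.-‿cong (x∙yz≈y∙xz _ _ _) ⟩
        - (two * (fromℕ (odd k) * 1/ (odd k)))
          ≈⟨ K.-‿cong (K.trans (K.*-congˡ (K.1/-inverse (odd k))) (K.*-identityʳ two)) ⟩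
        - two ∎
      zeros : ∀ n → n ×ₙ 0# ≈ 0#
      zeros = AlgK.GradedDerivation.δ-0 euler
      Dc : ∀ n → n ×ₙ SerK.oddSeries c n ≈ logDerivative n
      Dc = oddSeries-rel K.rawSemiring K.rawSemiring (λ n x y → n ×ₙ x ≈ y) zeros coefficient

    f-same-0 : ∀ t → f t t 0 ≈ 1#
    f-same-0 t = K.trans (K.+-identityʳ _) (K.trans (K.*-identityʳ _) K.1/1≈1)

    [-1]^-suc : ∀ n → [-1]^ suc n ≈ - [-1]^ n
    [-1]^-suc n = -1*x≈-x _

    ×ₙ-cancelˡ : ∀ n {x y} → suc n ×ₙ x ≈ suc n ×ₙ y → x ≈ y
    ×ₙ-cancelˡ n {x} {y} e = K.×1-cancelˡ (suc n) (K.trans (scalar x) (K.trans e (K.sym (scalar y))))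
      where
      scalar : ∀ z → fromℕ (suc n) * z ≈ suc n ×ₙ z
      scalar z = K.trans (×-assoc-* (suc n) 1# z) (×-congʳ (suc n) (K.*-identityˡ z))

    -- The factor n makes the statement hold at n = 0 as well, where f t t 0 is 1 and
    -- not 2. Since logDerivative has coefficients of period 2, the differential
    -- equation becomes (n + 2) fₙ₊₂ = -2 fₙ₊₁ + n fₙ.
    ×-f-same : ∀ t n → n ×ₙ f t t n ≈ n ×ₙ (two * [-1]^ n)
    ×-f-same t zero = K.refl
    ×-f-same t (suc zero) = begin
      1 ×ₙ f t t 1                                     ≈⟨ f-euler t 1 ⟩
      0# * f t t 1 ⊹ (- two * f t t 0 ⊹ 0#)            ≈⟨ K.+-cong (K.zeroˡ _) (K.+-identityʳ _) ⟩
      0# ⊹ - two * f t t 0                             ≈⟨ K.+-identityˡ _ ⟩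
      - two * f t t 0                                  ≈⟨ K.*-congˡ (f-same-0 t) ⟩
      - two * 1#                                       ≈⟨ -‿distribˡ-* _ _ ⟨
      - (two * 1#)                                     ≈⟨ -‿distribʳ-* _ _ ⟩
      two * - 1#                                       ≈⟨ K.*-congˡ ([-1]^-suc 0) ⟨
      two * [-1]^ 1                                    ≈⟨ K.+-identityʳ _ ⟨
      1 ×ₙ (two * [-1]^ 1)                             ∎
    ×-f-same t (suc (suc n)) = begin
      (2 + n) ×ₙ f t t (2 + n)
        ≈⟨ f-euler t (2 + n) ⟩
      0# * f t t (2 + n) ⊹ (- two * f t t (suc n) ⊹ (logDerivative ⋆ f t t) n)
        ≈⟨ K.trans (K.+-congʳ (K.zeroˡ _)) (K.+-identityˡ _) ⟩
      - two * f t t (suc n) ⊹ (logDerivative ⋆ f t t) n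
        ≈⟨ K.+-cong (K.*-congˡ (×ₙ-cancelˡ n (×-f-same t (suc n)))) (K.trans (K.sym (f-euler t n)) (×-f-same t n)) ⟩
      - two * (two * [-1]^ suc n) ⊹ n ×ₙ (two * [-1]^ n)
        ≈⟨ K.+-cong (K.trans (K.sym (-‿distribˡ-* _ _)) (-‿distribʳ-* _ _)) (×-congʳ n (K.*-congˡ (K.sym sign))) ⟩
      two * - (two * [-1]^ suc n) ⊹ n ×ₙ y
        ≈⟨ K.+-congʳ (K.*-congˡ (K.trans (-‿distribʳ-* _ _) (K.*-congˡ (K.sym ([-1]^-suc (suc n)))))) ⟩
      two * y ⊹ n ×ₙ y
        ≈⟨ K.+-congʳ (K.trans (×-assoc-* 2 1# y) (×-congʳ 2 (K.*-identityˡ y))) ⟩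
      2 ×ₙ y ⊹ n ×ₙ y
        ≈⟨ ×-homo-+ y 2 n ⟨
      (2 + n) ×ₙ y ∎
      where
      y = two * [-1]^ suc (suc n)
      sign : [-1]^ suc (suc n) ≈ [-1]^ n
      sign = K.trans ([-1]^-suc (suc n)) (K.trans (K.-‿cong ([-1]^-suc n)) (-‿involutive _))

    f-same : ∀ t n → f t t (suc n) ≈ two * [-1]^ suc n
    f-same t n = ×ₙ-cancelˡ n (×-f-same t (suc n))

  module _ where
    open SetoidReasoning ≋-setoid

    -- For equal parameters f t t is (1 - u)/(1 + u), with coefficients 1, -2, 2, -2, ….
    𝒬-same : ∀ t r m → 𝒬 t t r m ≋
      q t r ⊗ q t m ⊕ fromℕ 2 • (∑[ k ∈ 1 ⋯ m ] (([-1]^ k) • (q t (r + k) ⊗ q t (m ∸ k))))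
    𝒬-same t r m = begin
      𝒬 t t r m
        ≈⟨ 𝒬-expansion t t r m ⟩
      f t t 0 • (q t (r + 0) ⊗ q t m) ⊕ ∑[ k ∈ 1 ⋯ m ] (f t t k • x k)
        ≈⟨ ⊕-cong first rest ⟩
      q t r ⊗ q t m ⊕ fromℕ 2 • (∑[ k ∈ 1 ⋯ m ] (([-1]^ k) • x k)) ∎
      where
      x : ℕ → Γ
      x k = q t (r + k) ⊗ q t (m ∸ k)
      first : f t t 0 • (q t (r + 0) ⊗ q t m) ≋ q t r ⊗ q t m
      first = begin
        f t t 0 • (q t (r + 0) ⊗ q t m)   ≈⟨ ⊗-cong (con-cong (f-same-0 t)) ≋-refl ⟩
        𝟏 ⊗ (q t (r + 0) ⊗ q t m)         ≈⟨ ⊗-identityˡ _ ⟩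
        q t (r + 0) ⊗ q t m               ≡⟨ ≡.cong (λ i → q t i ⊗ q t m) (ℕₚ.+-identityʳ r) ⟩
        q t r ⊗ q t m                     ∎
      rest : ∑[ k ∈ 1 ⋯ m ] (f t t k • x k) ≋ fromℕ 2 • (∑[ k ∈ 1 ⋯ m ] (([-1]^ k) • x k))
      rest = begin
        ∑[ k ∈ 1 ⋯ m ] (f t t k • x k)
          ≈⟨ ConvΓ.sum-cong-≋ {m} {λ i → f t t (suc (toℕ i)) • x (suc (toℕ i))} {λ i → fromℕ 2 • (([-1]^ (suc (toℕ i))) • x (suc (toℕ i)))}
             (λ i → ≋-trans (⊗-cong (≋-trans (con-cong (f-same t (toℕ i))) (con-* _ _)) ≋-refl) (⊗-assoc _ _ _)) ⟩
        ∑[ k ∈ 1 ⋯ m ] (fromℕ 2 • (([-1]^ k) • x k))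
          ≈⟨ ConvΓ.*-distribˡ-sum {m} (con (fromℕ 2)) (λ i → ([-1]^ (suc (toℕ i))) • x (suc (toℕ i))) ⟨
        fromℕ 2 • (∑[ k ∈ 1 ⋯ m ] (([-1]^ k) • x k)) ∎

proposition3p5 : (let open Fock ℚ⟨t,s⟩ in
    ∀ (r m : ℕ) →
    𝒬 t s r m ≋ ∑[ k ∈ 0 ⋯ m ] (f t s k • (q t (r + k) ⊗ q s (m ∸ k))))
    ×
    (let open Fock ℚ⟨t⟩ in
    ∀ (r m : ℕ) →
    𝒬 t₀ t₀ r m ≋
    q t₀ r ⊗ q t₀ m ⊕
    fromℕ 2 • (∑[ k ∈ 1 ⋯ m ] (([-1]^ k) • (q t₀ (r + k) ⊗ q t₀ (m ∸ k)))))
proposition3p5 = FockProperties.𝒬-expansion ℚ⟨t,s⟩ t s , FockProperties.𝒬-same ℚ⟨t⟩ t₀
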